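{- For any constant $\frac12<\alpha<1$ there exist constants $c>0$ and $\delta_0>0$ (depending on $\alpha$) such that for every $0<\delta\le\delta_0$ there is a weighted graph $G$ such that for any set of weight classes (not necessarily a weight partition, possibly overlapping) $[\ell_1,r_1),[\ell_2,r_2),\dots,[\ell_k,r_k)\subseteq\mathbb{R}$, the following holds: if all possible choices of $\alpha$-approximate maximum weight matchings $M_i$ of $G_{[\ell_i,r_i)}$ ($i=1,\dots,k$) satisfy $$\mu_w(M_1\cup M_2\cup\dots\cup M_k)\ge(\alpha-\delta)\cdot\mu_w(G),$$ then there is a weight class $[\ell_i,r_i)$ such that $r_i\ge\ell_i\cdot\exp(c\,\delta^{ -1})$.
   Context: $G=(V,E)$ is a finite undirected graph with positive edge weights $w$. A matching is a set of vertex-disjoint edges; $w(M)=\sum_{e\in M}w(e)$; $\mu_w(H)$ is the maximum of $w(M)$ over matchings $M$ in $H$. An $\alpha$-approximate maximum weight matching of $H$ is a matching $M\subseteq H$ with $w(M)\ge\alpha\,\mu_w(H)$. For $I\subseteq\mathbb{R}$, $G_I$ is the subgraph of $G$ consisting of the edges $e$ with $w(e)\in I$. -}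

module Defs where

open import Level using (0ℓ; suc)
open import Algebra.Bundles using (CommutativeRing)
open import Data.Bool.Base using (if_then_else_; _∧_)
open import Data.Fin.Base using (Fin; toℕ)
open import Data.Fin.Properties using (_≟_; all?)
open import Data.Fin.Subset using (Subset; inside; outside; _∈_; _⊆_)
open import Data.Fin.Subset.Properties using (_∈?_; _⊆?_)
open import Data.List.Base as List using (List; []; _∷_; [_]; _++_; filter)
open import Data.Nat.Base as ℕ using (ℕ; _!)
open import Data.Product.Base using (_×_; ∃; ∃-syntax; proj₁; proj₂)
open import Data.Sum.Base using (_⊎_)
open import Data.Vec.Base as Vec using (Vec; lookup; tabulate)
open import Function.Bundles using (_⇔_)
open import Relation.Binary.Bundles using (DecTotalOrder)
open import Relation.Binary.Core using (Rel)
open import Relation.Binary.Definitions using (Decidable)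
open import Relation.Binary.PropositionalEquality.Core using (_≡_; _≢_)
open import Relation.Binary.Structures using (IsDecTotalOrder)
open import Relation.Nullary.Decidable.Core using (Dec; does; _×-dec_; _⊎-dec_; _→-dec_)
open import Relation.Unary using (Pred)
import Algebra.Properties.Monoid.Mult as Mult
import Algebra.Properties.Monoid.Sum as Sum
import Algebra.Properties.Semiring.Exp as Exp
import Data.List.Extrema as Extrema
import Relation.Binary.Construct.NonStrictToStrict as NonStrictToStrict

-- The real numbers, axiomatised as a Dedekind-complete totally ordered field.
-- Such a structure is unique up to isomorphism, and classically ℝ is one;
-- decidability of the order is the classical dichotomy x ≤ y or x ≰ y.

record Reals : Set (suc 0ℓ) where
  infix  4 _≤_
  infix  8 _⁻¹
  field
    commutativeRing : CommutativeRing 0ℓ 0ℓ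

  open CommutativeRing commutativeRing public
    renaming (Carrier to ℝ; refl to ≈-refl; sym to ≈-sym; trans to ≈-trans;
              reflexive to ≈-reflexive; isEquivalence to ≈-isEquivalence)

  field
    _≤_             : Rel ℝ 0ℓ
    isDecTotalOrder : IsDecTotalOrder _≈_ _≤_

  decTotalOrder : DecTotalOrder 0ℓ 0ℓ 0ℓ
  decTotalOrder = record { isDecTotalOrder = isDecTotalOrder }

  open IsDecTotalOrder isDecTotalOrder public using (_≤?_)
    renaming (_≟_ to _≈?_)
  open DecTotalOrder decTotalOrder public using (totalOrder)
  open NonStrictToStrict _≈_ _≤_ public using (_<_)

  _<?_ : Decidable _<_
  _<?_ = NonStrictToStrict.<-decidable _≈_ _≤_ _≈?_ _≤?_

  -- The second component says that nothing below s is an upper bound, with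
  -- the element witnessing this given explicitly.
  IsSupremum : Pred ℝ 0ℓ → ℝ → Set
  IsSupremum P s = (∀ x → P x → x ≤ s) × (∀ y → y < s → ∃[ x ] P x × y < x)

  field
    +-monoˡ-≤   : ∀ x y z → x ≤ y → x + z ≤ y + z
    *-nonneg    : ∀ x y → 0# ≤ x → 0# ≤ y → 0# ≤ x * y
    0≉1         : 0# ≉ 1#
    -- The value of 0# ⁻¹ is left unspecified.
    _⁻¹         : ℝ → ℝ
    *-inverseʳ  : ∀ x → x ≉ 0# → x * x ⁻¹ ≈ 1#
    supremum    : (P : Pred ℝ 0ℓ) → ∃ P → (∃[ u ] (∀ x → P x → x ≤ u)) →
                  ∃ (IsSupremum P)

  ½ : ℝ
  ½ = (1# + 1#) ⁻¹

  open Sum +-monoid public using (sum; sum-syntax)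
  open Mult +-monoid public using () renaming (_×_ to _·_)
  open Exp semiring public using (_^_)

  _ConvergesTo_ : (ℕ → ℝ) → ℝ → Set
  s ConvergesTo l = ∀ ε → 0# < ε →
    ∃[ N ] (∀ n → N ℕ.≤ n → s n - l < ε × l - s n < ε)

  expPartialSum : ℝ → ℕ → ℝ
  expPartialSum x n = ∑[ k < n ] (x ^ toℕ k * ((toℕ k !) · 1#) ⁻¹)

  infix 4 _IsExpOf_
  _IsExpOf_ : ℝ → ℝ → Set
  y IsExpOf x = expPartialSum x ConvergesTo y

allSubsets : ∀ n → List (Subset n)
allSubsets ℕ.zero    = [ Vec.[] ]
allSubsets (ℕ.suc n) = List.map (outside Vec.∷_) (allSubsets n)
                    ++ List.map (inside  Vec.∷_) (allSubsets n)

module Weighted (R : Reals) where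
  open Reals R public

  -- Finite simple graphs with positive edge weights.  Vertices and edges are
  -- numbered; the order of the two endpoints of an edge carries no meaning,
  -- since everything below depends only on incidence.
  record WeightedGraph : Set where
    field
      ∣V∣ ∣E∣   : ℕ
      endpoints : Fin ∣E∣ → Fin ∣V∣ × Fin ∣V∣

    _IncidentTo_ : Fin ∣V∣ → Fin ∣E∣ → Set
    v IncidentTo e = v ≡ proj₁ (endpoints e) ⊎ v ≡ proj₂ (endpoints e)

    field
      loopless : ∀ e → proj₁ (endpoints e) ≢ proj₂ (endpoints e)
      simple   : ∀ e f → (∀ v → v IncidentTo e ⇔ v IncidentTo f) → e ≡ f
      w        : Fin ∣E∣ → ℝ
      w-pos    : ∀ e → 0# < w e

  -- Subgraphs are identified with their edge sets; ⊤ is the graph itself.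
  module _ (G : WeightedGraph) where
    open WeightedGraph G

    Subgraph : Set
    Subgraph = Subset ∣E∣

    IsMatching : Pred (Subset ∣E∣) 0ℓ
    IsMatching M = ∀ e f v → e ∈ M → f ∈ M →
                   v IncidentTo e → v IncidentTo f → e ≡ f

    incidentTo? : Decidable _IncidentTo_
    incidentTo? v e = (v ≟ proj₁ (endpoints e)) ⊎-dec (v ≟ proj₂ (endpoints e))

    isMatching? : ∀ M → Dec (IsMatching M)
    isMatching? M = all? λ e → all? λ f → all? λ v →
      (e ∈? M) →-dec ((f ∈? M) →-dec
      (incidentTo? v e →-dec (incidentTo? v f →-dec (e ≟ f))))

    weight : Subset ∣E∣ → ℝ
    weight M = ∑[ e < ∣E∣ ] (if lookup M e then w e else 0#)

    IsMatchingIn : Subgraph → Pred (Subset ∣E∣) 0ℓ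
    IsMatchingIn H M = IsMatching M × M ⊆ H

    matchingsIn : Subgraph → List (Subset ∣E∣)
    matchingsIn H = filter (λ M → isMatching? M ×-dec (M ⊆? H)) (allSubsets ∣E∣)

    -- The default value 0# is the weight of the empty matching.
    μ : Subgraph → ℝ
    μ H = Extrema.max totalOrder 0# (List.map weight (matchingsIn H))

    IsApproxMWM : ℝ → Subgraph → Pred (Subset ∣E∣) 0ℓ
    IsApproxMWM α H M = IsMatchingIn H M × α * μ H ≤ weight M

    weightClass : ℝ → ℝ → Subgraph
    weightClass ℓ r = tabulate λ e → does (ℓ ≤? w e) ∧ does (w e <? r)

{-# OPTIONS --safe #-}
module Submission where

open import Defs
open import Algebra.Bundles using (CommutativeRing)
open import Data.Bool.Base using (Bool; true; false; if_then_else_; _∧_)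
open import Data.Bool.Properties using (¬-not)
open import Data.Empty using (⊥-elim)
open import Data.Fin.Base using (Fin; zero; suc; toℕ; inject₁; fromℕ; combine; remQuot)
open import Data.Fin.Patterns using (0F; 1F; 2F)
open import Data.Fin.Properties using (any?; toℕ-inject₁; toℕ-fromℕ; inject₁-injective; suc-injective;
  combine-injective; combine-injectiveʳ; combine-remQuot; remQuot-combine)
open import Data.Fin.Subset using (Subset; inside; outside; ⊤; ⋃; _∈_; _⊆_)
open import Data.Fin.Subset.Properties using (x∈p∪q⁻; ∉⊥; ∈⊤; _⊆?_)
open import Data.Integer.Base as ℤ using (ℤ; -[1+_]) renaming (+_ to pos)
import Data.Integer.Properties as ℤ
open import Data.List.Base as List using (List; []; _∷_; _++_; replicate; length; tabulate)
import Data.List.Extrema as Extrema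
import Data.List.Membership.Propositional as List
open import Data.List.Membership.Propositional.Properties using (∈-map⁺; ∈-++⁺ˡ; ∈-++⁺ʳ; ∈-filter⁺; ∈-filter⁻)
import Data.List.Relation.Unary.All as All
import Data.List.Relation.Unary.All.Properties as All
open import Data.List.Relation.Unary.Any using (here)
open import Data.Maybe.Base as Maybe using (Maybe; just; nothing)
open import Data.Nat.Base as ℕ using (ℕ; zero; suc; _!)
import Data.Nat.Properties as ℕ
open import Data.Nat.Solver using (module +-*-Solver)
open import Data.Product.Base using (Σ-syntax; ∃-syntax; _×_; _,_; proj₁; proj₂)
open import Data.Sum.Base using (_⊎_; inj₁; inj₂)
open import Data.Vec.Base as Vec using ([]; _∷_; lookup)
open import Data.Vec.Properties using (lookup∘tabulate; []=⇒lookup; lookup⇒[]=)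
open import Function.Bundles using (Equivalence)
open import Relation.Binary.Bundles using (DecTotalOrder)
open import Relation.Binary.Consequences using (dec⇒weaklyDec)
open import Relation.Binary.PropositionalEquality as ≡ using (_≡_; _≢_)
open import Relation.Nullary using (¬_; Dec; yes; no; contradiction; does)
open import Relation.Nullary.Decidable using (_×-dec_; dec-true; decidable-stable)

import Algebra.Properties.AbelianGroup as AbelianGroupProperties
import Algebra.Properties.Monoid.Sum as MonoidSum
import Algebra.Properties.Ring as RingProperties
import Algebra.Properties.Semiring.Mult as SemiringMult
import Algebra.Properties.Semiring.Mult.TCOptimised as SemiringMultTC
import Algebra.Solver.Ring as RingSolver
import Algebra.Solver.Ring.AlmostCommutativeRing as ACR
import Relation.Binary.Properties.DecTotalOrder as DecTotalOrderProperties
import Relation.Binary.Reasoning.PartialOrder as PartialOrderReasoning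
import Relation.Binary.Reasoning.Setoid as SetoidReasoning

-- Take disjoint paths with edge weights heavy, light, light: at level t these
-- are α qᵗ and twice (1 - α) qᵗ, with the number of paths proportional to q⁻ᵗ,
-- so that every level has the same total weight.  The heavy edge alone is
-- exactly an α-fraction of the optimum of its path.  For a weight class
-- containing the light but not the heavy edges of a path, the adversary picks
-- the middle edge: optimal for that class, but worthless once another class
-- supplies the heavy edge.  Since α > ½, q > 1 can be chosen so that every
-- upper end of a class which cuts off the top weight falls between the light
-- and the heavy edges of some level, and the surplus obtained there lets the
-- adversary leave out some additional paths of minimum weight altogether.  A
-- class of ratio below exp(c/δ) misses the minimum or the maximum weight, so
-- the adversary can always leave these paths out; with Θ(1/δ) levels this
-- costs more than a δ-fraction of the optimum.

-- A ring solver with integer coefficients for an arbitrary commutative ring.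

module IntegerCoefficients {c ℓ} (R : CommutativeRing c ℓ) where
  open CommutativeRing R
  open SemiringMultTC semiring using (1+×; ×-homo-+; ×1-homo-*) renaming (_×_ to _·′_)
  open RingProperties ring
  open AbelianGroupProperties +-abelianGroup using (⁻¹-∙-comm; ⁻¹-involutive; ε⁻¹≈ε)
  open SetoidReasoning setoid

  -- The multiple `_·′_` takes `1` to exactly `1#`, so the constants `:0` and `:1` of the solver
  -- evaluate to `0#` and `1#` by computation.
  ⟦_⟧ℤ : ℤ → Carrier
  ⟦ pos n    ⟧ℤ = n ·′ 1#
  ⟦ -[1+ n ] ⟧ℤ = - (suc n ·′ 1#)

  ⟦-⟧ : ∀ i → ⟦ ℤ.- i ⟧ℤ ≈ - ⟦ i ⟧ℤ
  ⟦-⟧ (pos zero)    = sym ε⁻¹≈ε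
  ⟦-⟧ (pos (suc n)) = refl
  ⟦-⟧ -[1+ n ]      = sym (⁻¹-involutive _)

  ⟦⊖⟧ : ∀ m n → ⟦ m ℤ.⊖ n ⟧ℤ ≈ m ·′ 1# - n ·′ 1#
  ⟦⊖⟧ zero    zero    = sym (-‿inverseʳ 0#)
  ⟦⊖⟧ zero    (suc n) = sym (+-identityˡ _)
  ⟦⊖⟧ (suc m) zero    = sym (trans (+-congˡ ε⁻¹≈ε) (+-identityʳ _))
  ⟦⊖⟧ (suc m) (suc n) = begin
    ⟦ suc m ℤ.⊖ suc n ⟧ℤ                 ≡⟨ ≡.cong ⟦_⟧ℤ (ℤ.[1+m]⊖[1+n]≡m⊖n m n) ⟩
    ⟦ m ℤ.⊖ n ⟧ℤ                         ≈⟨ ⟦⊖⟧ m n ⟩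
    m ·′ 1# - n ·′ 1#                    ≈⟨ +-congʳ (+-identityʳ _) ⟨
    m ·′ 1# + 0# - n ·′ 1#               ≈⟨ +-congʳ (+-congˡ (-‿inverseʳ 1#)) ⟨
    m ·′ 1# + (1# - 1#) - n ·′ 1#        ≈⟨ +-congʳ (+-assoc _ _ _) ⟨
    m ·′ 1# + 1# - 1# - n ·′ 1#          ≈⟨ +-assoc _ _ _ ⟩
    m ·′ 1# + 1# + (- 1# - n ·′ 1#)      ≈⟨ +-cong (+-comm _ _) (⁻¹-∙-comm _ _) ⟩
    1# + m ·′ 1# - (1# + n ·′ 1#)        ≈⟨ +-cong (1+× m 1#) (-‿cong (1+× n 1#)) ⟨
    suc m ·′ 1# - suc n ·′ 1#            ∎

  ⟦+⟧ : ∀ i j → ⟦ i ℤ.+ j ⟧ℤ ≈ ⟦ i ⟧ℤ + ⟦ j ⟧ℤ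
  ⟦+⟧ (pos m)  (pos n)  = ×-homo-+ 1# m n
  ⟦+⟧ (pos m)  -[1+ n ] = ⟦⊖⟧ m (suc n)
  ⟦+⟧ -[1+ m ] (pos n)  = trans (⟦⊖⟧ n (suc m)) (+-comm _ _)
  ⟦+⟧ -[1+ m ] -[1+ n ] = begin
    ⟦ -[1+ m ] ℤ.+ -[1+ n ] ⟧ℤ
      ≡⟨ ≡.cong ⟦_⟧ℤ (ℤ.neg-distrib-+ ℤ.+[1+ m ] ℤ.+[1+ n ]) ⟨
    ⟦ ℤ.- (ℤ.+[1+ m ] ℤ.+ ℤ.+[1+ n ]) ⟧ℤ         ≈⟨ ⟦-⟧ (ℤ.+[1+ m ] ℤ.+ ℤ.+[1+ n ]) ⟩
    - ((suc m ℕ.+ suc n) ·′ 1#)                  ≈⟨ -‿cong (×-homo-+ 1# (suc m) (suc n)) ⟩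
    - (suc m ·′ 1# + suc n ·′ 1#)                ≈⟨ ⁻¹-∙-comm _ _ ⟨
    - (suc m ·′ 1#) - suc n ·′ 1#                ∎

  ⟦*⟧-pos : ∀ m j → ⟦ pos m ℤ.* j ⟧ℤ ≈ ⟦ pos m ⟧ℤ * ⟦ j ⟧ℤ
  ⟦*⟧-pos m (pos n)  = trans (reflexive (≡.cong ⟦_⟧ℤ (≡.sym (ℤ.pos-* m n)))) (×1-homo-* m n)
  ⟦*⟧-pos m -[1+ n ] = begin
    ⟦ pos m ℤ.* -[1+ n ] ⟧ℤ          ≡⟨ ≡.cong ⟦_⟧ℤ (ℤ.neg-distribʳ-* (pos m) ℤ.+[1+ n ]) ⟨
    ⟦ ℤ.- (pos m ℤ.* ℤ.+[1+ n ]) ⟧ℤ  ≈⟨ ⟦-⟧ (pos m ℤ.* ℤ.+[1+ n ]) ⟩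
    - ⟦ pos m ℤ.* ℤ.+[1+ n ] ⟧ℤ      ≈⟨ -‿cong (⟦*⟧-pos m ℤ.+[1+ n ]) ⟩
    - (m ·′ 1# * (suc n ·′ 1#))      ≈⟨ -‿distribʳ-* _ _ ⟩
    m ·′ 1# * - (suc n ·′ 1#)        ∎

  ⟦*⟧ : ∀ i j → ⟦ i ℤ.* j ⟧ℤ ≈ ⟦ i ⟧ℤ * ⟦ j ⟧ℤ
  ⟦*⟧ (pos m)  j = ⟦*⟧-pos m j
  ⟦*⟧ -[1+ m ] j = begin
    ⟦ -[1+ m ] ℤ.* j ⟧ℤ          ≡⟨ ≡.cong ⟦_⟧ℤ (ℤ.neg-distribˡ-* ℤ.+[1+ m ] j) ⟨
    ⟦ ℤ.- (ℤ.+[1+ m ] ℤ.* j) ⟧ℤ  ≈⟨ ⟦-⟧ (ℤ.+[1+ m ] ℤ.* j) ⟩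
    - ⟦ ℤ.+[1+ m ] ℤ.* j ⟧ℤ      ≈⟨ -‿cong (⟦*⟧-pos (suc m) j) ⟩
    - (suc m ·′ 1# * ⟦ j ⟧ℤ)     ≈⟨ -‿distribˡ-* _ _ ⟩
    - (suc m ·′ 1#) * ⟦ j ⟧ℤ     ∎

  ℤ-morphism : ℤ.+-*-rawRing ACR.-Raw-AlmostCommutative⟶ ACR.fromCommutativeRing R
  ℤ-morphism = record
    { ⟦_⟧ = ⟦_⟧ℤ ; +-homo = ⟦+⟧ ; *-homo = ⟦*⟧ ; -‿homo = ⟦-⟧
    ; 0-homo = refl ; 1-homo = refl }

  open RingSolver ℤ.+-*-rawRing (ACR.fromCommutativeRing R) ℤ-morphism
    (λ i j → Maybe.map (λ i≡j → reflexive (≡.cong ⟦_⟧ℤ i≡j)) (dec⇒weaklyDec ℤ._≟_ i j)) public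
    hiding (_:×_)

  :0 :1 : ∀ {n} → Polynomial n
  :0 = con (pos 0)
  :1 = con (pos 1)

-- Ordered field arithmetic and the Archimedean property.

module OrderedField (R : Reals) where
  open Reals R hiding (zero)
  open IntegerCoefficients commutativeRing public
    using (solve; :0; :1; _:+_; _:*_; _:-_; :-_; _:=_)
  open DecTotalOrder decTotalOrder public using (poset; total)
    renaming (refl to ≤-refl; reflexive to ≤-reflexive; trans to ≤-trans; antisym to ≤-antisym)
  open DecTotalOrderProperties decTotalOrder public
    using (<⇒≱; ≰⇒>; ≤⇒≯; ≮⇒≥)
  open PartialOrderReasoning poset public

  <⇒≤ : ∀ {x y} → x < y → x ≤ y
  <⇒≤ = proj₁

  +-mono-≤ : ∀ {x y u v} → x ≤ y → u ≤ v → x + u ≤ y + v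
  +-mono-≤ {x} {y} {u} {v} x≤y u≤v = begin
    x + u  ≤⟨ +-monoˡ-≤ x y u x≤y ⟩
    y + u  ≈⟨ +-comm y u ⟩
    u + y  ≤⟨ +-monoˡ-≤ u v y u≤v ⟩
    v + y  ≈⟨ +-comm v y ⟩
    y + v  ∎

  +-nonneg : ∀ {x y} → 0# ≤ x → 0# ≤ y → 0# ≤ x + y
  +-nonneg 0≤x 0≤y = ≤-trans (≤-reflexive (≈-sym (+-identityʳ 0#))) (+-mono-≤ 0≤x 0≤y)

  *-nonneg′ : ∀ {x y} → 0# ≤ x → 0# ≤ y → 0# ≤ x * y
  *-nonneg′ = *-nonneg _ _

  x≤y⇒0≤y-x : ∀ {x y} → x ≤ y → 0# ≤ y - x
  x≤y⇒0≤y-x {x} {y} x≤y = begin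
    0#     ≈⟨ -‿inverseʳ x ⟨
    x - x  ≤⟨ +-monoˡ-≤ x y (- x) x≤y ⟩
    y - x  ∎

  -- The main tool for inequalities: the difference is written as an expression `d` built from known
  -- nonnegative pieces, and the identity for `d` is left to the ring solver.
  by-difference : ∀ {x y d} → 0# ≤ d → y - x ≈ d → x ≤ y
  by-difference {x} {y} {d} 0≤d y-x≈d = begin
    x          ≈⟨ +-identityˡ x ⟨
    0# + x     ≤⟨ +-monoˡ-≤ 0# (y - x) x (≤-trans 0≤d (≤-reflexive (≈-sym y-x≈d))) ⟩
    y - x + x  ≈⟨ solve 2 (λ x y → y :- x :+ x := y) ≈-refl x y ⟩
    y          ∎

  *-monoˡ-≤ : ∀ {x y z} → 0# ≤ z → x ≤ y → z * x ≤ z * y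
  *-monoˡ-≤ {x} {y} {z} 0≤z x≤y = by-difference (*-nonneg′ 0≤z (x≤y⇒0≤y-x x≤y))
    (solve 3 (λ x y z → z :* y :- z :* x := z :* (y :- x)) ≈-refl x y z)

  *-monoʳ-≤ : ∀ {x y z} → 0# ≤ z → x ≤ y → x * z ≤ y * z
  *-monoʳ-≤ {x} {y} {z} 0≤z x≤y = begin
    x * z  ≈⟨ *-comm x z ⟩
    z * x  ≤⟨ *-monoˡ-≤ 0≤z x≤y ⟩
    z * y  ≈⟨ *-comm z y ⟩
    y * z  ∎

  0≤1 : 0# ≤ 1#
  0≤1 with total 0# 1#
  ... | inj₁ 0≤1 = 0≤1
  -- If `1# ≤ 0#`, then `0# - 1#` is nonnegative, and so is its square, which is `1#`.
  ... | inj₂ 1≤0 = ≤-trans (*-nonneg′ 0≤-1 0≤-1)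
    (≤-reflexive (solve 0 ((:0 :- :1) :* (:0 :- :1) := :1) ≈-refl))
    where 0≤-1 = x≤y⇒0≤y-x 1≤0

  0<1 : 0# < 1#
  0<1 = 0≤1 , 0≉1

  0<⇒≉0 : ∀ {x} → 0# < x → x ≉ 0#
  0<⇒≉0 (_ , 0≉x) x≈0 = 0≉x (≈-sym x≈0)

  *-pos : ∀ {x y} → 0# < x → 0# < y → 0# < x * y
  *-pos {x} {y} 0<x 0<y = *-nonneg′ (<⇒≤ 0<x) (<⇒≤ 0<y) , λ 0≈xy → 0<⇒≉0 0<y (begin-equality
    y                  ≈⟨ *-identityˡ y ⟨
    1# * y             ≈⟨ *-congʳ (*-inverseʳ x (0<⇒≉0 0<x)) ⟨
    x * x ⁻¹ * y       ≈⟨ solve 3 (λ x x⁻¹ y → x :* x⁻¹ :* y := x⁻¹ :* (x :* y)) ≈-refl x (x ⁻¹) y ⟩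
    x ⁻¹ * (x * y)     ≈⟨ *-congˡ 0≈xy ⟨
    x ⁻¹ * 0#          ≈⟨ zeroʳ _ ⟩
    0#                 ∎)

  ⁻¹-pos : ∀ {x} → 0# < x → 0# < x ⁻¹
  ⁻¹-pos {x} 0<x = ≰⇒> λ x⁻¹≤0 → <⇒≱ 0<1 (begin
    1#        ≈⟨ *-inverseʳ x (0<⇒≉0 0<x) ⟨
    x * x ⁻¹  ≤⟨ *-monoˡ-≤ (<⇒≤ 0<x) x⁻¹≤0 ⟩
    x * 0#    ≈⟨ zeroʳ x ⟩
    0#        ∎)

  *-cancelˡ-≤ : ∀ {x y z} → 0# < z → z * x ≤ z * y → x ≤ y
  *-cancelˡ-≤ {x} {y} {z} 0<z zx≤zy = begin
    x               ≈⟨ cancel x ⟨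
    z ⁻¹ * (z * x)  ≤⟨ *-monoˡ-≤ (<⇒≤ (⁻¹-pos 0<z)) zx≤zy ⟩
    z ⁻¹ * (z * y)  ≈⟨ cancel y ⟩
    y               ∎
    where
    cancel : ∀ t → z ⁻¹ * (z * t) ≈ t
    cancel t = begin-equality
      z ⁻¹ * (z * t)  ≈⟨ solve 3 (λ z z⁻¹ t → z⁻¹ :* (z :* t) := z :* z⁻¹ :* t) ≈-refl z (z ⁻¹) t ⟩
      z * z ⁻¹ * t    ≈⟨ *-congʳ (*-inverseʳ z (0<⇒≉0 0<z)) ⟩
      1# * t          ≈⟨ *-identityˡ t ⟩
      t               ∎

  +-pos : ∀ {x y} → 0# < x → 0# < y → 0# < x + y
  +-pos {x} {y} 0<x 0<y = begin-strict
    0#      <⟨ 0<x ⟩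
    x       ≤⟨ by-difference (<⇒≤ 0<y) (solve 2 (λ x y → x :+ y :- x := y) ≈-refl x y) ⟩
    x + y   ∎

  x*y⁻¹*y≈x : ∀ x {y} → 0# < y → x * y ⁻¹ * y ≈ x
  x*y⁻¹*y≈x x {y} 0<y = begin-equality
    x * y ⁻¹ * y    ≈⟨ solve 3 (λ x y y⁻¹ → x :* y⁻¹ :* y := x :* (y :* y⁻¹)) ≈-refl x y (y ⁻¹) ⟩
    x * (y * y ⁻¹)  ≈⟨ *-congˡ (*-inverseʳ y (0<⇒≉0 0<y)) ⟩
    x * 1#          ≈⟨ *-identityʳ x ⟩
    x               ∎

  x*y⁻¹≤z⇒x≤z*y : ∀ {x y z} → 0# < y → x * y ⁻¹ ≤ z → x ≤ z * y
  x*y⁻¹≤z⇒x≤z*y {x} {y} {z} 0<y xy⁻¹≤z = begin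
    x             ≈⟨ x*y⁻¹*y≈x x 0<y ⟨
    x * y ⁻¹ * y  ≤⟨ *-monoʳ-≤ (<⇒≤ 0<y) xy⁻¹≤z ⟩
    z * y         ∎

  x<y⇒0<y-x : ∀ {x y} → x < y → 0# < y - x
  x<y⇒0<y-x {x} {y} x<y = ≰⇒> λ y-x≤0 → <⇒≱ x<y (by-difference (x≤y⇒0≤y-x y-x≤0)
    (solve 2 (λ x y → x :- y := :0 :- (y :- x)) ≈-refl x y))

  x-y<x : ∀ {x y} → 0# < y → x - y < x
  x-y<x {x} {y} 0<y = ≰⇒> λ x≤x-y → <⇒≱ 0<y (by-difference (x≤y⇒0≤y-x x≤x-y)
    (solve 2 (λ x y → :0 :- y := x :- y :- x) ≈-refl x y))

  open SemiringMult semiring public using (×1-homo-*)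

  -- `ι (suc n)` computes to `1# + ι n`; the solver calls below rely on this shape.
  ι : ℕ → ℝ
  ι n = n · 1#

  ι-nonneg : ∀ n → 0# ≤ ι n
  ι-nonneg zero    = ≤-refl
  ι-nonneg (suc n) = +-nonneg 0≤1 (ι-nonneg n)

  1≤ι-suc : ∀ n → 1# ≤ ι (suc n)
  1≤ι-suc n = by-difference (ι-nonneg n)
    (solve 2 (λ o x → o :+ x :- o := x) ≈-refl 1# (ι n))

  ι-suc-pos : ∀ n → 0# < ι (suc n)
  ι-suc-pos n = begin-strict
    0#         <⟨ 0<1 ⟩
    1#         ≤⟨ 1≤ι-suc n ⟩
    ι (suc n)  ∎

  ^-nonneg : ∀ {x} n → 0# ≤ x → 0# ≤ x ^ n
  ^-nonneg zero    0≤x = 0≤1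
  ^-nonneg (suc n) 0≤x = *-nonneg′ 0≤x (^-nonneg n 0≤x)

  ^-pos : ∀ {x} n → 0# < x → 0# < x ^ n
  ^-pos zero    0<x = 0<1
  ^-pos (suc n) 0<x = *-pos 0<x (^-pos n 0<x)

  ^-mono-≤ : ∀ {x y} n → 0# ≤ x → x ≤ y → x ^ n ≤ y ^ n
  ^-mono-≤ zero    0≤x x≤y = ≤-refl
  ^-mono-≤ {x} {y} (suc n) 0≤x x≤y = begin
    x * x ^ n  ≤⟨ *-monoˡ-≤ 0≤x (^-mono-≤ n 0≤x x≤y) ⟩
    x * y ^ n  ≤⟨ *-monoʳ-≤ (^-nonneg n (≤-trans 0≤x x≤y)) x≤y ⟩
    y * y ^ n  ∎

  1≤x^n : ∀ {x} n → 1# ≤ x → 1# ≤ x ^ n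
  1≤x^n     zero    1≤x = ≤-refl
  1≤x^n {x} (suc n) 1≤x = begin
    1#         ≤⟨ 1≤x ⟩
    x          ≈⟨ *-identityʳ x ⟨
    x * 1#     ≤⟨ *-monoˡ-≤ (≤-trans 0≤1 1≤x) (1≤x^n n 1≤x) ⟩
    x * x ^ n  ∎

  sum-mono : ∀ {m} {f g : Fin m → ℝ} → (∀ i → f i ≤ g i) → sum f ≤ sum g
  sum-mono {zero}  f≤g = ≤-refl
  sum-mono {suc m} f≤g = +-mono-≤ (f≤g zero) (sum-mono λ i → f≤g (suc i))

  sum-nonneg : ∀ {m} {f : Fin m → ℝ} → (∀ i → 0# ≤ f i) → 0# ≤ sum f
  sum-nonneg {zero}  0≤f = ≤-refl
  sum-nonneg {suc m} 0≤f = +-nonneg (0≤f zero) (sum-nonneg λ i → 0≤f (suc i))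

  -- The naturals not exceeding x have a supremum s; one of them exceeds s - 1,
  -- so its successor exceeds s and hence x.
  floor : ∀ x → 0# ≤ x → ∃[ n ] ι n ≤ x × x < ι (suc n)
  floor x 0≤x with supremum (λ y → ∃[ n ] y ≈ ι n × ι n ≤ x)
                     (0# , 0 , ≈-refl , 0≤x)
                     (x , λ { y (n , y≈n , n≤x) → ≤-trans (≤-reflexive y≈n) n≤x })
  ... | s , ub , approx with approx (s - 1#) (x-y<x 0<1)
  ...   | y , (n , y≈n , n≤x) , s-1<y = n , n≤x , ≰⇒> λ n+1≤x →
    <⇒≱ s-1<y (begin
      y          ≈⟨ y≈n ⟩
      ι n        ≈⟨ solve 2 (λ o n → n := o :+ n :- o) ≈-refl 1# (ι n) ⟩
      ι (suc n) - 1#  ≤⟨ +-monoˡ-≤ _ _ (- 1#) (ub (ι (suc n)) (suc n , ≈-refl , n+1≤x)) ⟩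
      s - 1#     ∎)

  -- The bound is a successor so that the constants `K` and `B` obtained from it are positive.
  archimedean : ∀ x → ∃[ n ] x ≤ ι (suc n)
  archimedean x with total 0# x
  ... | inj₁ 0≤x = let n , _ , x<n+1 = floor x 0≤x in n , <⇒≤ x<n+1
  ... | inj₂ x≤0 = 0 , ≤-trans x≤0 (ι-nonneg 1)

-- Existence of the exponential and its comparison with powers of 1/(1 - h).

module Exponential (R : Reals) where
  open Reals R
  open OrderedField R
  open MonoidSum +-monoid using (sum-init-last; sum-cong-≗)

  !⁻¹ : ℕ → ℝ
  !⁻¹ n = ((n !) · 1#) ⁻¹

  ι!-pos : ∀ n → 0# < ι (n !)
  ι!-pos zero    = ι-suc-pos 0
  ι!-pos (suc n) = begin-strict
    0#                     <⟨ *-pos (ι-suc-pos n) (ι!-pos n) ⟩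
    ι (suc n) * ι (n !)    ≈⟨ ×1-homo-* (suc n) (n !) ⟨
    ι (suc n !)            ∎

  !⁻¹-nonneg : ∀ n → 0# ≤ !⁻¹ n
  !⁻¹-nonneg n = <⇒≤ (⁻¹-pos (ι!-pos n))

  !⁻¹-suc : ∀ n → ι (suc n) * !⁻¹ (suc n) ≈ !⁻¹ n
  !⁻¹-suc n = begin-equality
    s * !⁻¹ (suc n)                          ≈⟨ *-identityʳ _ ⟨
    s * !⁻¹ (suc n) * 1#                     ≈⟨ *-congˡ (*-inverseʳ _ (0<⇒≉0 (ι!-pos n))) ⟨
    s * !⁻¹ (suc n) * (ι (n !) * !⁻¹ n)
      ≈⟨ solve 4 (λ s c f d → s :* c :* (f :* d) := s :* f :* c :* d)
          ≈-refl s (!⁻¹ (suc n)) (ι (n !)) (!⁻¹ n) ⟩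
    s * ι (n !) * !⁻¹ (suc n) * !⁻¹ n        ≈⟨ *-congʳ (*-congʳ (×1-homo-* (suc n) (n !))) ⟨
    ι (suc n !) * !⁻¹ (suc n) * !⁻¹ n        ≈⟨ *-congʳ (*-inverseʳ _ (0<⇒≉0 (ι!-pos (suc n)))) ⟩
    1# * !⁻¹ n                               ≈⟨ *-identityˡ _ ⟩
    !⁻¹ n                                    ∎
    where s = ι (suc n)

  E : ℝ → ℕ → ℝ
  E = expPartialSum

  -- Sums over `Fin` unfold at their first term, whereas the inductions on partial sums append a
  -- last one.
  E-suc : ∀ x n → E x (suc n) ≈ E x n + x ^ n * !⁻¹ n
  E-suc x n = begin-equality
    E x (suc n)                                    ≈⟨ sum-init-last {n} (λ k → term (toℕ k)) ⟩
    sum {n} (λ k → term (toℕ (inject₁ k))) + term (toℕ (fromℕ n))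
      ≡⟨ ≡.cong₂ _+_ (sum-cong-≗ {n} λ k → ≡.cong term (toℕ-inject₁ k)) (≡.cong term (toℕ-fromℕ n)) ⟩
    E x n + term n                                 ∎
    where
    term : ℕ → ℝ
    term k = x ^ k * !⁻¹ k

  term-nonneg : ∀ {x} n → 0# ≤ x → 0# ≤ x ^ n * !⁻¹ n
  term-nonneg n 0≤x = *-nonneg′ (^-nonneg n 0≤x) (!⁻¹-nonneg n)

  E-≤-suc : ∀ {x} n → 0# ≤ x → E x n ≤ E x (suc n)
  E-≤-suc {x} n 0≤x = begin
    E x n                    ≈⟨ +-identityʳ _ ⟨
    E x n + 0#               ≤⟨ +-mono-≤ ≤-refl (term-nonneg n 0≤x) ⟩
    E x n + x ^ n * !⁻¹ n    ≈⟨ E-suc x n ⟨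
    E x (suc n)              ∎

  E-monoʳ-≤ : ∀ {x m n} → 0# ≤ x → m ℕ.≤ n → E x m ≤ E x n
  E-monoʳ-≤ {x} 0≤x m≤n = go (ℕ.≤⇒≤′ m≤n)
    where
    go : ∀ {m n} → m ℕ.≤′ n → E x m ≤ E x n
    go (ℕ.≤′-reflexive ≡.refl) = ≤-refl
    go (ℕ.≤′-step {n} m≤n)     = ≤-trans (go m≤n) (E-≤-suc n 0≤x)

  E-monoˡ-≤ : ∀ {x y} n → 0# ≤ x → x ≤ y → E x n ≤ E y n
  E-monoˡ-≤ zero    0≤x x≤y = ≤-refl
  E-monoˡ-≤ {x} {y} (suc n) 0≤x x≤y = begin
    E x (suc n)              ≈⟨ E-suc x n ⟩
    E x n + x ^ n * !⁻¹ n
      ≤⟨ +-mono-≤ (E-monoˡ-≤ n 0≤x x≤y) (*-monoʳ-≤ (!⁻¹-nonneg n) (^-mono-≤ n 0≤x x≤y)) ⟩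
    E y n + y ^ n * !⁻¹ n    ≈⟨ E-suc y n ⟨
    E y (suc n)              ∎

  -- The mean value bound for a power on the interval from `x` to `x + h`, where the derivative is
  -- largest at the right end. The inductive step multiplies the previous case by `x`; the remaining
  -- difference is `h * (ι (suc k) * h * (x + h) ^ k)`.
  ^-suc-+-≤ : ∀ {x h} → 0# ≤ x → 0# ≤ h → ∀ k →
              (x + h) ^ suc k ≤ x ^ suc k + ι (suc k) * h * (x + h) ^ k
  ^-suc-+-≤ {x} {h} 0≤x 0≤h zero = by-difference ≤-refl
    (solve 2 (λ x h → x :* :1 :+ (:1 :+ :0) :* h :* :1 :- (x :+ h) :* :1
                   := :0) ≈-refl x h)
  ^-suc-+-≤ {x} {h} 0≤x 0≤h (suc k) = by-difference
    (+-nonneg (*-nonneg′ 0≤x (x≤y⇒0≤y-x (^-suc-+-≤ 0≤x 0≤h k)))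
              (*-nonneg′ 0≤h (*-nonneg′ (*-nonneg′ (ι-nonneg (suc k)) 0≤h)
                                        (^-nonneg k (+-nonneg 0≤x 0≤h)))))
    (solve 5 (λ x h ι zᵏ xᵏ →
        x :* (x :* xᵏ) :+ (:1 :+ ι) :* h :* ((x :+ h) :* zᵏ) :- (x :+ h) :* ((x :+ h) :* zᵏ)
        := x :* (x :* xᵏ :+ ι :* h :* zᵏ :- (x :+ h) :* zᵏ) :+ h :* (ι :* h :* zᵏ))
      ≈-refl x h (ι (suc k)) ((x + h) ^ k) (x ^ k))

  -- A discrete form of exp′ = exp.
  E-suc-+-≤ : ∀ {x h} → 0# ≤ x → 0# ≤ h → ∀ n → E (x + h) (suc n) ≤ E x (suc n) + h * E (x + h) n
  E-suc-+-≤ {x} {h} 0≤x 0≤h zero    = ≤-reflexive (≈-sym (≈-trans (+-congˡ (zeroʳ h)) (+-identityʳ _)))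
  E-suc-+-≤ {x} {h} 0≤x 0≤h (suc n) = begin
    E z (2 ℕ.+ n)                            ≈⟨ E-suc z (suc n) ⟩
    E z (suc n) + z ^ suc n * c
      ≤⟨ +-mono-≤ (E-suc-+-≤ 0≤x 0≤h n) (*-monoʳ-≤ (!⁻¹-nonneg (suc n)) (^-suc-+-≤ 0≤x 0≤h n)) ⟩
    E x (suc n) + h * E z n + (x ^ suc n + ι (suc n) * h * z ^ n) * c
      ≈⟨ solve 7 (λ a h b d ι e c → a :+ h :* b :+ (d :+ ι :* h :* e) :* c
                               := a :+ d :* c :+ h :* (b :+ e :* (ι :* c)))
           ≈-refl (E x (suc n)) h (E z n) (x ^ suc n) (ι (suc n)) (z ^ n) c ⟩
    E x (suc n) + x ^ suc n * c + h * (E z n + z ^ n * (ι (suc n) * c))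
      ≈⟨ +-cong (E-suc x (suc n)) (*-congˡ (≈-trans (E-suc z n) (+-congˡ (*-congˡ (≈-sym (!⁻¹-suc n)))))) ⟨
    E x (2 ℕ.+ n) + h * E z (suc n)          ∎
    where
    z = x + h
    c = !⁻¹ (suc n)

  -- The inequality exp h ≤ 1/(1 - h) for partial sums: in `E-suc-+-≤` the term `E (x + h) n` is
  -- enlarged to `E (x + h) (suc n)` and moved to the left.
  E-+-≤ : ∀ {x h} → 0# ≤ x → 0# ≤ h → ∀ n → (1# - h) * E (x + h) n ≤ E x n
  E-+-≤ {x} {h} 0≤x 0≤h zero    = ≤-reflexive (zeroʳ _)
  E-+-≤ {x} {h} 0≤x 0≤h (suc n) = by-difference
    (+-nonneg (x≤y⇒0≤y-x (E-suc-+-≤ 0≤x 0≤h n))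
              (*-nonneg′ 0≤h (x≤y⇒0≤y-x (E-≤-suc n (+-nonneg 0≤x 0≤h)))))
    (solve 4 (λ h a b c → b :- (:1 :- h) :* a := b :+ h :* c :- a :+ h :* (a :- c))
      ≈-refl h (E (x + h) (suc n)) (E x (suc n)) (E (x + h) n))

  E-0 : ∀ n → E 0# n ≤ 1#
  E-0 zero          = 0≤1
  E-0 (suc zero)    = ≤-reflexive (begin-equality
    1# * !⁻¹ 0 + 0#   ≈⟨ +-identityʳ _ ⟩
    1# * !⁻¹ 0        ≈⟨ *-congʳ (+-identityʳ 1#) ⟨
    ι 1 * !⁻¹ 0       ≈⟨ *-inverseʳ _ (0<⇒≉0 (ι!-pos 0)) ⟩
    1#                ∎)
  E-0 (suc (suc n)) = begin
    E 0# (2 ℕ.+ n)                                ≈⟨ E-suc 0# (suc n) ⟩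
    E 0# (suc n) + 0# * 0# ^ n * !⁻¹ (suc n)      ≈⟨ +-congˡ (≈-trans (*-congʳ (zeroˡ _)) (zeroˡ _)) ⟩
    E 0# (suc n) + 0#                             ≈⟨ +-identityʳ _ ⟩
    E 0# (suc n)                                  ≤⟨ E-0 (suc n) ⟩
    1#                                            ∎

  -- The interval from 0 to `x` is covered by `t` steps of length `h`, and by `E-+-≤` each step
  -- multiplies the partial sum by at most 1/(1 - h), which is `q`.
  E-≤-^ : ∀ {h q x} t n → 0# ≤ h → 0# ≤ q → q * (1# - h) ≈ 1# →
          0# ≤ x → x ≤ ι t * h → E x n ≤ q ^ t
  E-≤-^ {h} zero n 0≤h 0≤q q[1-h]≈1 0≤x x≤0 =
    ≤-trans (E-monoˡ-≤ n 0≤x (≤-trans x≤0 (≤-reflexive (zeroˡ h)))) (E-0 n)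
  E-≤-^ {h} {q} {x} (suc t) n 0≤h 0≤q q[1-h]≈1 0≤x x≤th = begin
    E x n                             ≤⟨ E-monoˡ-≤ n 0≤x (≤-trans x≤th (≤-reflexive
                                           (solve 2 (λ t h → (:1 :+ t) :* h := t :* h :+ h)
                                               ≈-refl (ι t) h))) ⟩
    E (ι t * h + h) n                 ≈⟨ *-identityˡ _ ⟨
    1# * E (ι t * h + h) n            ≈⟨ *-congʳ q[1-h]≈1 ⟨
    q * (1# - h) * E (ι t * h + h) n  ≈⟨ *-assoc q _ _ ⟩
    q * ((1# - h) * E (ι t * h + h) n) ≤⟨ *-monoˡ-≤ 0≤q (E-+-≤ 0≤th 0≤h n) ⟩
    q * E (ι t * h) n                 ≤⟨ *-monoˡ-≤ 0≤q (E-≤-^ t n 0≤h 0≤q q[1-h]≈1 0≤th ≤-refl) ⟩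
    q * q ^ t                         ∎
    where
    0≤th : 0# ≤ ι t * h
    0≤th = *-nonneg′ (ι-nonneg t) 0≤h

  -- The exponential is given only as a relation, so a value has to be produced: the supremum of the
  -- partial sums, which increase because `x` is nonnegative. It inherits their upper bound `b`.
  exp-exists : ∀ {x b} → 0# ≤ x → (∀ n → E x n ≤ b) → ∃[ y ] y IsExpOf x × 0# ≤ y × y ≤ b
  exp-exists {x} {b} 0≤x E≤b
    with supremum (λ z → ∃[ n ] z ≈ E x n) (E x 0 , 0 , ≈-refl)
           (b , λ { z (n , z≈E) → ≤-trans (≤-reflexive z≈E) (E≤b n) })
  -- The empty partial sum is `0#`, so `E≤y 0` is the claim `0# ≤ y`.
  ... | y , ub , approx = y , converges , E≤y 0 , ≮⇒≥ λ b<y →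
      let z , (n , z≈E) , b<z = approx b b<y in
      <⇒≱ b<z (≤-trans (≤-reflexive z≈E) (E≤b n))
    where
    E≤y : ∀ n → E x n ≤ y
    E≤y n = ub (E x n) (n , ≈-refl)

    converges : y IsExpOf x
    converges ε 0<ε with approx (y - ε) (x-y<x 0<ε)
    ... | z , (N , z≈E) , y-ε<z = N , λ n N≤n → below n , above n N≤n
      where
      below : ∀ n → E x n - y < ε
      below n = begin-strict
        E x n - y  ≤⟨ +-monoˡ-≤ _ _ (- y) (E≤y n) ⟩
        y - y      ≈⟨ -‿inverseʳ y ⟩
        0#         <⟨ 0<ε ⟩
        ε          ∎
      above : ∀ n → N ℕ.≤ n → y - E x n < ε
      above n N≤n = ≰⇒> λ ε≤ → <⇒≱ y-ε<z (begin
        z      ≈⟨ z≈E ⟩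
        E x N  ≤⟨ E-monoʳ-≤ 0≤x N≤n ⟩
        E x n
          ≤⟨ by-difference (x≤y⇒0≤y-x ε≤) (solve 3 (λ y ε e → y :- ε :- e := y :- e :- ε)
              ≈-refl y ε (E x n)) ⟩
        y - ε  ∎)

-- Enumeration of subsets and bounds on the weight of an optimal matching.

∈-allSubsets : ∀ {n} (M : Subset n) → M List.∈ allSubsets n
∈-allSubsets []                    = here ≡.refl
∈-allSubsets (outside ∷ M)         = ∈-++⁺ˡ (∈-map⁺ (outside ∷_) (∈-allSubsets M))
∈-allSubsets {suc n} (inside ∷ M)  =
  ∈-++⁺ʳ (List.map (outside ∷_) (allSubsets n)) (∈-map⁺ (inside ∷_) (∈-allSubsets M))

∈-⋃-tabulate⁻ : ∀ {n k x} (M : Fin k → Subset n) → x ∈ ⋃ (tabulate M) → ∃[ i ] x ∈ M i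
∈-⋃-tabulate⁻ {k = zero}  M x∈⊥ = ⊥-elim (∉⊥ x∈⊥)
∈-⋃-tabulate⁻ {k = suc k} M x∈⋃ with x∈p∪q⁻ (M zero) _ x∈⋃
... | inj₁ x∈M₀ = zero , x∈M₀
... | inj₂ x∈⋃′ = let i , x∈Mᵢ = ∈-⋃-tabulate⁻ (λ i → M (suc i)) x∈⋃′ in suc i , x∈Mᵢ

module MaximumWeightMatching (R : Reals) (G : Weighted.WeightedGraph R) where
  open Weighted R hiding (zero)
  open OrderedField R using (≤-trans; ≤-refl)

  weight≤μ : ∀ {H M} → IsMatchingIn G H M → weight G M ≤ μ G H
  weight≤μ {H} {M} M-in-H =
      All.lookup (Extrema.xs≤max totalOrder 0# (List.map (weight G) (matchingsIn G H)))
    (∈-map⁺ (weight G) (∈-filter⁺ (λ M → isMatching? G M ×-dec (M ⊆? H)) (∈-allSubsets M) M-in-H))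

  -- The hypothesis `0# ≤ b` covers the default value of the maximum.
  μ≤ : ∀ {H b} → 0# ≤ b → (∀ M → IsMatchingIn G H M → weight G M ≤ b) → μ G H ≤ b
  μ≤ {H} 0≤b weight≤b = Extrema.max≤v⁺ totalOrder 0≤b
    (All.map⁺ (All.tabulate λ {M} M∈ → weight≤b M
      (proj₂ (∈-filter⁻ (λ M → isMatching? G M ×-dec (M ⊆? H)) {xs = allSubsets _} M∈))))

-- Contribution of a single path to a weight class.

module WeightClasses (R : Reals) where
  open Weighted R hiding (zero)
  open OrderedField R

  select : Bool → ℝ → ℝ
  select b x = if b then x else 0#

  select-nonneg : ∀ b {x} → 0# < x → 0# ≤ select b x
  select-nonneg true  0<x = <⇒≤ 0<x
  select-nonneg false 0<x = ≤-refl

  select-mono : ∀ b c {x} → 0# < x → (b ≡ true → c ≡ true) → select b x ≤ select c x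
  select-mono true  c 0<x b⇒c rewrite b⇒c ≡.refl = ≤-refl
  select-mono false c 0<x b⇒c = select-nonneg c 0<x

  -- Meant for the two light edges of a path: they are adjacent, so a matching within the class
  -- gains at most one of them.
  select-disjoint : ∀ b b′ c {x} → 0# < x → (b ≡ true → c ≡ true) → (b′ ≡ true → c ≡ true) →
    (b ≡ true → b′ ≢ true) → select b x + select b′ x ≤ select c x
  select-disjoint true  true  c 0<x b⇒c b′⇒c disj = contradiction ≡.refl (disj ≡.refl)
  select-disjoint true  false c 0<x b⇒c b′⇒c disj =
    ≤-trans (≤-reflexive (+-identityʳ _)) (select-mono true c 0<x b⇒c)
  select-disjoint false b′    c 0<x b⇒c b′⇒c disj =
    ≤-trans (≤-reflexive (+-identityˡ _)) (select-mono b′ c 0<x b′⇒c)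

  inClass : ℝ → ℝ → ℝ → Bool
  inClass ℓ r x = does (ℓ ≤? x) ∧ does (x <? r)

  inClass⁺ : ∀ {ℓ r x} → ℓ ≤ x → x < r → inClass ℓ r x ≡ true
  inClass⁺ {ℓ} {r} {x} ℓ≤x x<r = ≡.cong₂ _∧_ (dec-true (ℓ ≤? x) ℓ≤x) (dec-true (x <? r) x<r)

  inClass⁻ : ∀ {ℓ r x} → inClass ℓ r x ≡ true → ℓ ≤ x × x < r
  inClass⁻ {ℓ} {r} {x} = toProof (ℓ ≤? x) (x <? r)
    where
    toProof : {P Q : Set} (P? : Dec P) (Q? : Dec Q) → does P? ∧ does Q? ≡ true → P × Q
    toProof (yes p) (yes q) _ = p , q

  inClass⁻-< : ∀ {ℓ r x} → r ≤ x → inClass ℓ r x ≡ false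
  inClass⁻-< {ℓ} {r} {x} r≤x = ¬-not λ eq → ≤⇒≯ r≤x (proj₂ (inClass⁻ {ℓ} {r} {x} eq))

  -- Bounds what a matching within the class can take from one path. The heavy edge and the last
  -- light edge are disjoint, hence the sum; the two light edges are adjacent, hence only one `l`.
  classBound : ℝ → ℝ → ℝ → ℝ → ℝ
  classBound ℓ r h l = select (inClass ℓ r h) h + select (inClass ℓ r l) l

  -- The flag `κ` tells whether the adversary uses the path at all. It prefers the heavy edge and
  -- falls back on a light one.
  adversaryGain : Bool → ℝ → ℝ → ℝ → ℝ → ℝ
  adversaryGain κ ℓ r h l = select κ (if inClass ℓ r h then h else select (inClass ℓ r l) l)

-- Disjoint paths of three edges and the adversary's matchings in them.

module PathForest (R : Reals) {n : ℕ} (heavy light : Fin n → Reals.ℝ R)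
  (heavy-pos : ∀ i → Reals._<_ R (Reals.0# R) (heavy i))
  (light-pos : ∀ i → Reals._<_ R (Reals.0# R) (light i)) where
  open Weighted R hiding (zero)
  open OrderedField R
  open WeightClasses R

  vertex : Fin n → Fin 4 → Fin (n ℕ.* 4)
  vertex = combine

  edge : Fin n → Fin 3 → Fin (n ℕ.* 3)
  edge = combine

  -- Edge `j` joins the positions `j` and `j + 1` of its path. The middle edge `1F` thus meets both
  -- others, and `0F` and `2F` are disjoint.
  ends : Fin n × Fin 3 → Fin (n ℕ.* 4) × Fin (n ℕ.* 4)
  ends (i , j) = vertex i (inject₁ j) , vertex i (suc j)

  edgeWeight : Fin n × Fin 3 → ℝ
  edgeWeight (i , 0F) = heavy i
  edgeWeight (i , 1F) = light i
  edgeWeight (i , 2F) = light i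

  edgeWeight-pos : ∀ ij → 0# < edgeWeight ij
  edgeWeight-pos (i , 0F) = heavy-pos i
  edgeWeight-pos (i , 1F) = light-pos i
  edgeWeight-pos (i , 2F) = light-pos i

  inject₁≢suc : ∀ {m} (j : Fin m) → inject₁ j ≢ suc j
  inject₁≢suc j eq = ℕ.1+n≢n (≡.trans (≡.cong toℕ (≡.sym eq)) (toℕ-inject₁ j))

  -- A common left end, or a common right end, determines the path and the position on it. If the
  -- ends match crosswise, each edge would be the successor of the other, giving `j′ ≡ 2 + j′` on
  -- positions.
  simple-path : ∀ ij i′j′ →
    (∀ v → (v ≡ proj₁ (ends ij) ⊎ v ≡ proj₂ (ends ij)) →
           (v ≡ proj₁ (ends i′j′) ⊎ v ≡ proj₂ (ends i′j′))) → ij ≡ i′j′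
  simple-path (i , j) (i′ , j′) ⊆ends
    with ⊆ends _ (inj₁ ≡.refl) | ⊆ends _ (inj₂ ≡.refl)
  ... | inj₁ eq | _ with ≡.refl , j≡j′ ← combine-injective i (inject₁ j) i′ (inject₁ j′) eq
    = ≡.cong (i ,_) (inject₁-injective j≡j′)
  ... | _ | inj₂ eq with ≡.refl , j≡j′ ← combine-injective i (suc j) i′ (suc j′) eq
    = ≡.cong (i ,_) (suc-injective j≡j′)
  ... | inj₂ eq₁ | inj₁ eq₂ = contradiction cycle (ℕ.m≢1+n+m (toℕ j′) {1})
    where
    eq₁′ = ≡.cong toℕ (combine-injectiveʳ i (inject₁ j) i′ (suc j′) eq₁)
    eq₂′ = ≡.cong toℕ (combine-injectiveʳ i (suc j) i′ (inject₁ j′) eq₂)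
    cycle : toℕ j′ ≡ suc (suc (toℕ j′))
    cycle = ≡.trans (≡.sym (toℕ-inject₁ j′)) (≡.trans (≡.sym eq₂′)
      (≡.cong suc (≡.trans (≡.sym (toℕ-inject₁ j)) eq₁′)))

  forest : WeightedGraph
  forest = record
    { ∣V∣       = n ℕ.* 4
    ; ∣E∣       = n ℕ.* 3
    ; endpoints = λ e → ends (remQuot 3 e)
    ; loopless  =
        λ e eq → (let i , j = remQuot {n} 3 e in inject₁≢suc j (combine-injectiveʳ i (inject₁ j) i (suc j) eq))
    ; simple    = λ e f e⇔f → ≡.trans (≡.sym (combine-remQuot {n} 3 e)) (≡.trans
        (≡.cong (λ ij → edge (proj₁ ij) (proj₂ ij))
          (simple-path (remQuot 3 e) (remQuot 3 f) λ v → Equivalence.to (e⇔f v)))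
        (combine-remQuot {n} 3 f))
    ; w         = λ e → edgeWeight (remQuot 3 e)
    ; w-pos     = λ e → edgeWeight-pos (remQuot 3 e)
    }

  open WeightedGraph forest using (w; _IncidentTo_; endpoints)
  open MaximumWeightMatching R forest

  w-edge : ∀ i j → w (edge i j) ≡ edgeWeight (i , j)
  w-edge i j = ≡.cong edgeWeight (remQuot-combine i j)

  sum-edges : ∀ m (g : Fin (m ℕ.* 3) → ℝ) →
    ∑[ e < m ℕ.* 3 ] g e ≈ ∑[ i < m ] (g (combine i 0F) + (g (combine i 1F) + g (combine i 2F)))
  sum-edges zero    g = ≈-refl
  sum-edges (suc m) g = ≈-trans
    (+-congˡ (+-congˡ (+-congˡ (sum-edges m (λ e → g (suc (suc (suc e))))))))
    (solve 4 (λ a b c d → a :+ (b :+ (c :+ d)) := a :+ (b :+ c) :+ d) ≈-refl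
      (g 0F) (g 1F) (g 2F) _)

  pathWeight : Subset (n ℕ.* 3) → Fin n → ℝ
  pathWeight M i = select (lookup M (edge i 0F)) (heavy i)
    + (select (lookup M (edge i 1F)) (light i) + select (lookup M (edge i 2F)) (light i))

  open MonoidSum +-monoid using (sum-cong-≗; sum-cong-≋)

  weight-pathWeight : ∀ M → weight forest M ≈ ∑[ i < n ] pathWeight M i
  weight-pathWeight M = ≈-trans (sum-edges n _) (≈-reflexive (sum-cong-≗ λ i →
    ≡.cong₂ _+_ (edge≡ i 0F) (≡.cong₂ _+_ (edge≡ i 1F) (edge≡ i 2F))))
    where
    edge≡ : ∀ i j →
      select (lookup M (edge i j)) (w (edge i j)) ≡ select (lookup M (edge i j)) (edgeWeight (i , j))
    edge≡ i j = ≡.cong (select (lookup M (edge i j))) (w-edge i j)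

  incident-inject₁ : ∀ i j → vertex i (inject₁ j) IncidentTo edge i j
  incident-inject₁ i j = inj₁ (≡.cong (λ ij → proj₁ (ends ij)) (≡.sym (remQuot-combine i j)))

  incident-suc : ∀ i j → vertex i (suc j) IncidentTo edge i j
  incident-suc i j = inj₂ (≡.cong (λ ij → proj₂ (ends ij)) (≡.sym (remQuot-combine i j)))

  not-consecutive : ∀ {M} → IsMatching forest M → ∀ i (j : Fin 2) →
    lookup M (edge i (inject₁ j)) ≡ true → lookup M (edge i (suc j)) ≢ true
  not-consecutive {M} matching i j ∈₁ ∈₂ = inject₁≢suc j (combine-injectiveʳ i (inject₁ j) i (suc j)
    -- The shared vertex: `inject₁ (suc j)` and `suc (inject₁ j)` agree by computation.
    (matching (edge i (inject₁ j)) (edge i (suc j)) (vertex i (inject₁ (suc j)))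
      (lookup⇒[]= _ M ∈₁) (lookup⇒[]= _ M ∈₂)
      (incident-suc i (inject₁ j)) (incident-inject₁ i (suc j))))

  -- The matchings of one path that occur: `outer` serves the lower bound on the optimum of the
  -- whole graph, the other three are the moves of the adversary.
  data Choice : Set where
    none first middle outer : Choice

  pick : Choice → Fin 3 → Bool
  pick none   _  = false
  pick first  0F = true
  pick first  _  = false
  pick middle 1F = true
  pick middle _  = false
  pick outer  1F = false
  pick outer  _  = true

  choiceWeight : Choice → Fin n → ℝ
  choiceWeight none   i = 0#
  choiceWeight first  i = heavy i
  choiceWeight middle i = light i
  choiceWeight outer  i = heavy i + light i

  picked : (Fin n → Choice) → Fin n × Fin 3 → Bool
  picked f (i , j) = pick (f i) j

  chosen : (Fin n → Choice) → Subset (n ℕ.* 3)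
  chosen f = Vec.tabulate λ e → picked f (remQuot 3 e)

  lookup-chosen : ∀ f e → lookup (chosen f) e ≡ picked f (remQuot 3 e)
  lookup-chosen f = lookup∘tabulate (λ e → picked f (remQuot 3 e))

  lookup-chosen-edge : ∀ f i j → lookup (chosen f) (edge i j) ≡ pick (f i) j
  lookup-chosen-edge f i j =
      ≡.trans (lookup-chosen f (edge i j)) (≡.cong (picked f) (remQuot-combine i j))

  weight-chosen : ∀ f → weight forest (chosen f) ≈ ∑[ i < n ] choiceWeight (f i) i
  weight-chosen f = ≈-trans (weight-pathWeight (chosen f)) (sum-cong-≋ per-path)
    where
    per-path : ∀ i → pathWeight (chosen f) i ≈ choiceWeight (f i) i
    per-path i rewrite lookup-chosen-edge f i 0F | lookup-chosen-edge f i 1F | lookup-chosen-edge f i 2F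
      with f i
    ... | none   = ≈-trans (+-identityˡ _) (+-identityˡ _)
    ... | first  = ≈-trans (+-congˡ (+-identityˡ _)) (+-identityʳ _)
    ... | middle = ≈-trans (+-identityˡ _) (+-identityʳ _)
    ... | outer  = +-congˡ (+-identityˡ _)

  -- The equation `inject₁ j ≡ suc k` encodes that edge `k` ends where edge `j` begins.
  pick-spread : ∀ c j k → inject₁ j ≡ suc k → pick c j ≡ true → pick c k ≢ true
  pick-spread none   j  k  _ () _
  pick-spread first  0F k  () _ _
  pick-spread first  1F k  _ () _
  pick-spread first  2F k  _ () _
  pick-spread middle 0F k  () _ _
  pick-spread middle 1F 0F _ _ ()
  pick-spread middle 1F 1F () _ _
  pick-spread middle 1F 2F () _ _
  pick-spread middle 2F k  _ () _
  pick-spread outer  0F k  () _ _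
  pick-spread outer  1F k  _ () _
  pick-spread outer  2F 0F () _ _
  pick-spread outer  2F 1F _ _ ()
  pick-spread outer  2F 2F () _ _

  -- Two edges that share a vertex on the same side coincide. Sharing it on opposite sides makes
  -- them consecutive on one path, which `pick-spread` excludes.
  chosen-matching : ∀ f → IsMatching forest (chosen f)
  chosen-matching f e e′ v e∈ e′∈ v-e v-e′ = ≡.trans (≡.sym (combine-remQuot {n} 3 e)) (≡.trans
    (≡.cong (λ ij → edge (proj₁ ij) (proj₂ ij))
      (meet (remQuot 3 e) (remQuot 3 e′) (∈⇒picked e∈) (∈⇒picked e′∈) v-e v-e′))
    (combine-remQuot {n} 3 e′))
    where
    ∈⇒picked : ∀ {e} → e ∈ chosen f → picked f (remQuot 3 e) ≡ true
    ∈⇒picked {e} e∈ = ≡.trans (≡.sym (lookup-chosen f e)) ([]=⇒lookup e∈)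

    meet : ∀ ij kl → picked f ij ≡ true → picked f kl ≡ true →
      (v ≡ proj₁ (ends ij) ⊎ v ≡ proj₂ (ends ij)) →
      (v ≡ proj₁ (ends kl) ⊎ v ≡ proj₂ (ends kl)) → ij ≡ kl
    meet (i , j) (k , l) p q (inj₁ v≡) (inj₁ v≡′)
      with ≡.refl , j≡l ← combine-injective i (inject₁ j) k (inject₁ l) (≡.trans (≡.sym v≡) v≡′)
      = ≡.cong (i ,_) (inject₁-injective j≡l)
    meet (i , j) (k , l) p q (inj₂ v≡) (inj₂ v≡′)
      with ≡.refl , j≡l ← combine-injective i (suc j) k (suc l) (≡.trans (≡.sym v≡) v≡′)
      = ≡.cong (i ,_) (suc-injective j≡l)
    meet (i , j) (k , l) p q (inj₁ v≡) (inj₂ v≡′)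
      with ≡.refl , j≡l ← combine-injective i (inject₁ j) k (suc l) (≡.trans (≡.sym v≡) v≡′)
      = contradiction q (pick-spread (f i) j l j≡l p)
    meet (i , j) (k , l) p q (inj₂ v≡) (inj₁ v≡′)
      with ≡.refl , j≡l ← combine-injective i (suc j) k (inject₁ l) (≡.trans (≡.sym v≡) v≡′)
      = contradiction p (pick-spread (f i) l j (≡.sym j≡l) q)

  chosen-⊆ : ∀ f H → (∀ i j → pick (f i) j ≡ true → lookup H (edge i j) ≡ true) → chosen f ⊆ H
  chosen-⊆ f H pick⇒∈ {e} e∈ =
      lookup⇒[]= e H (≡.trans (≡.cong (lookup H) (≡.sym (combine-remQuot {n} 3 e)))
    (pick⇒∈ _ _ (≡.trans (≡.sym (lookup-chosen f e)) ([]=⇒lookup e∈))))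

  chosen≤μ : ∀ f H → (∀ i j → pick (f i) j ≡ true → lookup H (edge i j) ≡ true) →
    ∑[ i < n ] choiceWeight (f i) i ≤ μ forest H
  chosen≤μ f H pick⇒∈ = ≤-trans (≤-reflexive (≈-sym (weight-chosen f)))
    (weight≤μ (chosen-matching f , chosen-⊆ f H pick⇒∈))

  μ≤∑ : ∀ H (b : Fin n → ℝ) → (∀ i → 0# ≤ b i) →
    (∀ M → IsMatchingIn forest H M → ∀ i → pathWeight M i ≤ b i) → μ forest H ≤ ∑[ i < n ] b i
  μ≤∑ H b 0≤b pathWeight≤b = μ≤ (sum-nonneg 0≤b) λ M M-in-H →
    ≤-trans (≤-reflexive (weight-pathWeight M)) (sum-mono (pathWeight≤b M M-in-H))

  lookup-weightClass : ∀ ℓ r i j →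
    lookup (weightClass forest ℓ r) (edge i j) ≡ inClass ℓ r (edgeWeight (i , j))
  lookup-weightClass ℓ r i j =
      ≡.trans (lookup∘tabulate _ (edge i j)) (≡.cong (inClass ℓ r) (w-edge i j))

  μ-weightClass : ∀ ℓ r →
    μ forest (weightClass forest ℓ r) ≤ ∑[ i < n ] classBound ℓ r (heavy i) (light i)
  μ-weightClass ℓ r = μ≤∑ (weightClass forest ℓ r) (λ i → classBound ℓ r (heavy i) (light i))
    (λ i → +-nonneg (select-nonneg _ (heavy-pos i)) (select-nonneg _ (light-pos i)))
    λ M (matching , M⊆H) i →
      let class : ∀ j → lookup M (edge i j) ≡ true → inClass ℓ r (edgeWeight (i , j)) ≡ true
          class j ∈M =
              ≡.trans (≡.sym (lookup-weightClass ℓ r i j)) ([]=⇒lookup (M⊆H (lookup⇒[]= (edge i j) M ∈M)))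
      in +-mono-≤ (select-mono _ _ (heavy-pos i) (class 0F))
           (select-disjoint _ _ _ (light-pos i) (class 1F) (class 2F) (not-consecutive matching i 1F))

  adversaryChoice : Bool → ℝ → ℝ → Fin n → Choice
  adversaryChoice false ℓ r i = none
  adversaryChoice true  ℓ r i = if inClass ℓ r (heavy i) then first else
    (if inClass ℓ r (light i) then middle else none)

  adversaryChoice-in : ∀ b ℓ r i j → pick (adversaryChoice b ℓ r i) j ≡ true →
    inClass ℓ r (edgeWeight (i , j)) ≡ true
  adversaryChoice-in true ℓ r i j eq with inClass ℓ r (heavy i) in h∈ | inClass ℓ r (light i) in l∈
  adversaryChoice-in true ℓ r i 0F eq | true  | _     = h∈
  adversaryChoice-in true ℓ r i 1F () | true  | _
  adversaryChoice-in true ℓ r i 2F () | true  | _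
  adversaryChoice-in true ℓ r i 0F () | false | true
  adversaryChoice-in true ℓ r i 1F eq | false | true  = l∈
  adversaryChoice-in true ℓ r i 2F () | false | true
  adversaryChoice-in true ℓ r i j  () | false | false

  -- This confines the union of all the adversary's matchings to the first two edges of each path,
  -- which are adjacent.
  adversaryChoice-2F : ∀ b ℓ r i → pick (adversaryChoice b ℓ r i) 2F ≢ true
  adversaryChoice-2F true ℓ r i eq with inClass ℓ r (heavy i) | inClass ℓ r (light i)
  adversaryChoice-2F true ℓ r i () | true  | _
  adversaryChoice-2F true ℓ r i () | false | true
  adversaryChoice-2F true ℓ r i () | false | false

  choiceWeight-adversary : ∀ κ ℓ r i →
    choiceWeight (adversaryChoice κ ℓ r i) i ≡ adversaryGain κ ℓ r (heavy i) (light i)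
  choiceWeight-adversary false ℓ r i = ≡.refl
  choiceWeight-adversary true  ℓ r i with inClass ℓ r (heavy i) | inClass ℓ r (light i)
  ... | true  | _     = ≡.refl
  ... | false | true  = ≡.refl
  ... | false | false = ≡.refl

  module Adversary (kept : Fin n → Bool) (light≤heavy : ∀ i → light i ≤ heavy i)
                   {k : ℕ} (ℓ r : Fin k → ℝ) where

    choice : Fin k → Fin n → Choice
    choice c i = adversaryChoice (kept i) (ℓ c) (r c) i

    M : Fin k → Subset (n ℕ.* 3)
    M c = chosen (choice c)

    M-in : ∀ c → IsMatchingIn forest (weightClass forest (ℓ c) (r c)) (M c)
    M-in c = chosen-matching (choice c) , chosen-⊆ (choice c) _ λ i j eq →
      ≡.trans (lookup-weightClass (ℓ c) (r c) i j) (adversaryChoice-in (kept i) (ℓ c) (r c) i j eq)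

    M-approx : ∀ {α} → 0# ≤ α → ∀ c →
      α * (∑[ i < n ] classBound (ℓ c) (r c) (heavy i) (light i)) ≤ ∑[ i < n ] adversaryGain (kept i) (ℓ c) (r c) (heavy i) (light i) →
      IsApproxMWM forest α (weightClass forest (ℓ c) (r c)) (M c)
    M-approx {α} 0≤α c bound = M-in c , (begin
      α * μ forest (weightClass forest (ℓ c) (r c))  ≤⟨ *-monoˡ-≤ 0≤α (μ-weightClass (ℓ c) (r c)) ⟩
      α * (∑[ i < n ] classBound (ℓ c) (r c) (heavy i) (light i))      ≤⟨ bound ⟩
      ∑[ i < n ] adversaryGain (kept i) (ℓ c) (r c) (heavy i) (light i)
        ≡⟨ sum-cong-≗ (λ i → choiceWeight-adversary (kept i) (ℓ c) (r c) i) ⟨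
      ∑[ i < n ] choiceWeight (choice c i) i         ≈⟨ weight-chosen (choice c) ⟨
      weight forest (M c)                            ∎)

    -- On a kept path the union offers only two adjacent edges, so a matching takes at most one, and
    -- the heavy one is at least as good. A path that is not kept offers nothing, whatever the
    -- classes are.
    μ-⋃ : μ forest (⋃ (tabulate M)) ≤ ∑[ i < n ] select (kept i) (heavy i)
    μ-⋃ = μ≤∑ _ _ (λ i → select-nonneg (kept i) (heavy-pos i)) per-path
      where
      per-path : ∀ N → IsMatchingIn forest (⋃ (tabulate M)) N → ∀ i →
        pathWeight N i ≤ select (kept i) (heavy i)
      per-path N (matching , N⊆⋃) i = bound _ _ _ (kept i) (some 0F) (some 1F)
        (not-consecutive matching i 0F) λ ∈N → let c , eq = some 2F ∈N in adversaryChoice-2F (kept i) (ℓ c) (r c) i eq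
        where
        some : ∀ j → lookup N (edge i j) ≡ true → ∃[ c ] pick (choice c i) j ≡ true
        some j ∈N = let c , e∈M = ∈-⋃-tabulate⁻ M (N⊆⋃ (lookup⇒[]= (edge i j) N ∈N)) in
          c , ≡.trans (≡.sym (lookup-chosen-edge (choice c) i j)) ([]=⇒lookup e∈M)
        -- The memberships of the three edges and the flag are generalised to Booleans, so that case
        -- analysis reduces every `select`.
        bound : ∀ b₀ b₁ b₂ κ → 
          (b₀ ≡ true → ∃[ c ] pick (adversaryChoice κ (ℓ c) (r c) i) 0F ≡ true) →
          (b₁ ≡ true → ∃[ c ] pick (adversaryChoice κ (ℓ c) (r c) i) 1F ≡ true) →
          (b₀ ≡ true → b₁ ≢ true) → b₂ ≢ true →
          select b₀ (heavy i) + (select b₁ (light i) + select b₂ (light i)) ≤ select κ (heavy i)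
        bound _     _     true  κ     _     _     _    b₂≢ = contradiction ≡.refl b₂≢
        bound true  true  false κ     _     _     disj _   = contradiction ≡.refl (disj ≡.refl)
        bound false false false κ     _     _     _    _   =
          ≤-trans (≤-reflexive (≈-trans (+-identityˡ _) (+-identityˡ _))) (select-nonneg κ (heavy-pos i))
        bound true  false false true  _     _     _    _   =
          ≤-reflexive (≈-trans (+-congˡ (+-identityˡ _)) (+-identityʳ _))
        bound false true  false true  _     _     _    _   =
          ≤-trans (≤-reflexive (≈-trans (+-identityˡ _) (+-identityʳ _))) (light≤heavy i)
        -- When the flag is `false` every choice is `none`, so no edge of the path lies in the
        -- union.
        bound true  b₁    false false some₀ _     _    _ with () ← proj₂ (some₀ ≡.refl)
        bound b₀    true  false false _     some₁ _    _ with () ← proj₂ (some₁ ≡.refl)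

  ∑≤μ-⊤ : ∑[ i < n ] (heavy i + light i) ≤ μ forest ⊤
  ∑≤μ-⊤ = chosen≤μ (λ _ → outer) ⊤ λ i j _ → []=⇒lookup (∈⊤ {x = edge i j})

-- Sums over a list of paths grouped into levels.

module ListSums (R : Reals) where
  open Reals R hiding (zero)
  open OrderedField R

  -- Indexing by `List.lookup` makes these sums literally the sums over path indices in the forest.
  ∑ₗ : ∀ {A : Set} → (A → ℝ) → List A → ℝ
  ∑ₗ f xs = ∑[ i < length xs ] f (List.lookup xs i)

  ∑ₗ-replicate-++ : ∀ {A : Set} (f : A → ℝ) n x xs → ∑ₗ f (replicate n x ++ xs) ≈ ι n * f x + ∑ₗ f xs
  ∑ₗ-replicate-++ f zero    x xs = ≈-sym (≈-trans (+-congʳ (zeroˡ _)) (+-identityˡ _))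
  ∑ₗ-replicate-++ f (suc n) x xs = ≈-trans (+-congˡ (∑ₗ-replicate-++ f n x xs))
    (solve 3 (λ f n s → f :+ (n :* f :+ s) := (:1 :+ n) :* f :+ s) ≈-refl (f x) (ι n) (∑ₗ f xs))

  ∑ₗ-scale-≤ : ∀ {A : Set} {α} (f g : A → ℝ) xs → (∀ x → α * f x ≤ g x) → α * ∑ₗ f xs ≤ ∑ₗ g xs
  ∑ₗ-scale-≤ {α = α} f g []       αf≤g = ≤-reflexive (zeroʳ α)
  ∑ₗ-scale-≤ {α = α} f g (x ∷ xs) αf≤g = begin
    α * (f x + ∑ₗ f xs)      ≈⟨ distribˡ α _ _ ⟩
    α * f x + α * ∑ₗ f xs    ≤⟨ +-mono-≤ (αf≤g x) (∑ₗ-scale-≤ f g xs αf≤g) ⟩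
    g x + ∑ₗ g xs            ∎

module Levels (R : Reals) (m : ℕ) (copies : ℕ → ℕ) where
  open Reals R hiding (zero)
  open OrderedField R
  open ListSums R

  -- nothing stands for a path that the adversary gives up, just t for a path
  -- of level t.
  levels : ℕ → List (Maybe ℕ)
  levels zero    = replicate m nothing ++ []
  levels (suc t) = replicate (copies t) (just t) ++ levels t

  ∑-levels-zero : ∀ f → ∑ₗ f (levels 0) ≈ ι m * f nothing
  ∑-levels-zero f = ≈-trans (∑ₗ-replicate-++ f m nothing []) (+-identityʳ _)

  ∑-levels-suc : ∀ f t → ∑ₗ f (levels (suc t)) ≈ ι (copies t) * f (just t) + ∑ₗ f (levels t)
  ∑-levels-suc f t = ∑ₗ-replicate-++ f (copies t) (just t) (levels t)

  ∑-levels-const : ∀ f {c} T → (∀ {t} → t ℕ.< T → ι (copies t) * f (just t) ≈ c) →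
    ∑ₗ f (levels T) ≈ ι m * f nothing + ι T * c
  ∑-levels-const f {c} zero    f≈c = ≈-trans (∑-levels-zero f)
    (≈-sym (≈-trans (+-congˡ (zeroˡ c)) (+-identityʳ _)))
  ∑-levels-const f {c} (suc T) f≈c = begin-equality
    ∑ₗ f (levels (suc T))                          ≈⟨ ∑-levels-suc f T ⟩
    ι (copies T) * f (just T) + ∑ₗ f (levels T)
      ≈⟨ +-cong (f≈c ℕ.≤-refl) (∑-levels-const f T λ t<T → f≈c (ℕ.m<n⇒m<1+n t<T)) ⟩
    c + (ι m * f nothing + ι T * c)
      ≈⟨ solve 3 (λ c d t → c :+ (d :+ t :* c) := d :+ (:1 :+ t) :* c)
          ≈-refl c (ι m * f nothing) (ι T) ⟩
    ι m * f nothing + ι (suc T) * c                ∎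

  module _ {α : ℝ} (f g : Maybe ℕ → ℝ) (αf≤g : ∀ t →
    α * f (just t) ≤ g (just t)) (0≤g : 0# ≤ g nothing) where

    -- Here `f` stands for the bound on a class and `g` for the adversary's gain. As every level
    -- meets the ratio `α`, the deficit is at most what the `m` given-up paths demand.
    ∑-levels-≤+ : ∀ t → α * ∑ₗ f (levels t) ≤ ∑ₗ g (levels t) + ι m * (α * f nothing)
    ∑-levels-≤+ zero    = begin
      α * ∑ₗ f (levels 0)                       ≈⟨ *-congˡ (∑-levels-zero f) ⟩
      α * (ι m * f nothing)                     ≤⟨ by-difference (*-nonneg′ (ι-nonneg m) 0≤g)
        (solve 4 (λ α m f g → m :* g :+ m :* (α :* f) :- α :* (m :* f) := m :* g)
            ≈-refl α (ι m) (f nothing) (g nothing)) ⟩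
      ι m * g nothing + ι m * (α * f nothing)   ≈⟨ +-congʳ (∑-levels-zero g) ⟨
      ∑ₗ g (levels 0) + ι m * (α * f nothing)   ∎
    ∑-levels-≤+ (suc t) = begin
      α * ∑ₗ f (levels (suc t))                           ≈⟨ *-congˡ (∑-levels-suc f t) ⟩
      α * (n * f (just t) + ∑ₗ f (levels t))
        ≤⟨ by-difference (+-nonneg (*-nonneg′ (ι-nonneg (copies t)) (x≤y⇒0≤y-x (αf≤g t))) (x≤y⇒0≤y-x (∑-levels-≤+ t)))
          (solve 7 (λ α n f sf g sg d → n :* g :+ sg :+ d :- α :* (n :* f :+ sf)
                := n :* (g :- α :* f) :+ (sg :+ d :- α :* sf))
            ≈-refl α n (f (just t)) (∑ₗ f (levels t)) (g (just t)) (∑ₗ g (levels t)) (ι m * (α * f nothing))) ⟩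
      n * g (just t) + ∑ₗ g (levels t) + ι m * (α * f nothing)  ≈⟨ +-congʳ (∑-levels-suc g t) ⟨
      ∑ₗ g (levels (suc t)) + ι m * (α * f nothing)       ∎
      where n = ι (copies t)

    -- A surplus on the single level `t` pays for the given-up paths: `∑-levels-≤+` accounts for
    -- everything below `t`, the surplus cancels the deficit at `t`, and the levels above preserve
    -- the inequality.
    ∑-levels-≤ : ∀ {t gain T} → t ℕ.< T → α * f (just t) + gain ≤ g (just t) →
      ι m * (α * f nothing) ≤ ι (copies t) * gain → α * ∑ₗ f (levels T) ≤ ∑ₗ g (levels T)
    ∑-levels-≤ {t} {gain} t<T αf+gain≤g loss≤gain = go (ℕ.≤⇒≤′ t<T)
      where
      go : ∀ {T} → suc t ℕ.≤′ T → α * ∑ₗ f (levels T) ≤ ∑ₗ g (levels T)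
      go (ℕ.≤′-reflexive ≡.refl) = begin
        α * ∑ₗ f (levels (suc t))                ≈⟨ *-congˡ (∑-levels-suc f t) ⟩
        α * (n * f (just t) + ∑ₗ f (levels t))
          ≤⟨ by-difference (+-nonneg (+-nonneg (*-nonneg′ (ι-nonneg (copies t)) (x≤y⇒0≤y-x αf+gain≤g))
                             (x≤y⇒0≤y-x (∑-levels-≤+ t))) (x≤y⇒0≤y-x loss≤gain))
            (solve 8 (λ α n f sf g sg d gain → n :* g :+ sg :- α :* (n :* f :+ sf)
               := n :* (g :- (α :* f :+ gain)) :+ (sg :+ d :- α :* sf) :+ (n :* gain :- d))
              ≈-refl α n (f (just t)) (∑ₗ f (levels t)) (g (just t)) (∑ₗ g (levels t)) (ι m * (α * f nothing)) gain) ⟩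
        n * g (just t) + ∑ₗ g (levels t)         ≈⟨ ∑-levels-suc g t ⟨
        ∑ₗ g (levels (suc t))                    ∎
        where n = ι (copies t)
      go (ℕ.≤′-step {T} t<T) = begin
        α * ∑ₗ f (levels (suc T))                ≈⟨ *-congˡ (∑-levels-suc f T) ⟩
        α * (n * f (just T) + ∑ₗ f (levels T))
          ≤⟨ by-difference (+-nonneg (*-nonneg′ (ι-nonneg (copies T)) (x≤y⇒0≤y-x (αf≤g T))) (x≤y⇒0≤y-x (go t<T)))
            (solve 6 (λ α n f sf g sg → n :* g :+ sg :- α :* (n :* f :+ sf)
                  := n :* (g :- α :* f) :+ (sg :- α :* sf))
              ≈-refl α n (f (just T)) (∑ₗ f (levels T)) (g (just T)) (∑ₗ g (levels T))) ⟩
        n * g (just T) + ∑ₗ g (levels T)         ≈⟨ ∑-levels-suc g T ⟨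
        ∑ₗ g (levels (suc T))                    ∎
        where n = ι (copies T)

-- The graph for given `α` and number of levels, and the adversary's answer to narrow classes.

module Construction (R : Reals) (α : Reals.ℝ R)
  (½<α : Reals._<_ R (Reals.½ R) α) (α<1 : Reals._<_ R α (Reals.1# R)) where
  open Weighted R hiding (zero)
  open OrderedField R
  open WeightClasses R
  open ListSums R

  a : ℝ
  a = 1# - α

  0<a : 0# < a
  0<a = x<y⇒0<y-x α<1

  0<2 : 0# < 1# + 1#
  0<2 = begin-strict
    0#       <⟨ 0<1 ⟩
    1#       ≤⟨ by-difference 0≤1 (solve 0 (:1 :+ :1 :- :1 := :1) ≈-refl) ⟩
    1# + 1#  ∎

  -- `α - a` equals twice `α - ½`. This gap leaves room for a ratio `q` above 1 with `a * q ≤ α`.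
  0<α-a : 0# < α - a
  0<α-a = begin-strict
    0#                                      <⟨ *-pos 0<2 (x<y⇒0<y-x ½<α) ⟩
    (1# + 1#) * (α - ½)
      ≈⟨ solve 2 (λ α h → (:1 :+ :1) :* (α :- h) := α :+ α :- (:1 :+ :1) :* h) ≈-refl α ½ ⟩
    α + α - (1# + 1#) * ½                   ≈⟨ +-congˡ (-‿cong (*-inverseʳ (1# + 1#) (0<⇒≉0 0<2))) ⟩
    α + α - 1#                              ≈⟨ solve 1 (λ α → α :+ α :- :1 := α :- (:1 :- α)) ≈-refl α ⟩
    α - a                                   ∎

  0≤α-a : 0# ≤ α - a
  0≤α-a = <⇒≤ 0<α-a

  0<α : 0# < α
  0<α = begin-strict
    0#  <⟨ ⁻¹-pos 0<2 ⟩
    ½   <⟨ ½<α ⟩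
    α   ∎

  0≤α : 0# ≤ α
  0≤α = <⇒≤ 0<α

  0≤a : 0# ≤ a
  0≤a = <⇒≤ 0<a

  a≤α : a ≤ α
  a≤α = by-difference 0≤α-a ≈-refl

  -- K is large enough for q = 1 + 1/K to satisfy a q ≤ α, and B for the
  -- surplus of one level, a² B m, to exceed the loss 2 α a m on m paths given up.
  K-1 B-1 : ℕ
  K-1 = proj₁ (archimedean (a * (α - a) ⁻¹))
  B-1 = proj₁ (archimedean ((1# + 1#) * a ⁻¹))

  K B : ℕ
  K = suc K-1
  B = suc B-1

  b : ℝ
  b = ι B

  a≤K[α-a] : a ≤ ι K * (α - a)
  a≤K[α-a] = x*y⁻¹≤z⇒x≤z*y 0<α-a (proj₂ (archimedean (a * (α - a) ⁻¹)))

  2≤ba : 1# + 1# ≤ b * a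
  2≤ba = x*y⁻¹≤z⇒x≤z*y 0<a (proj₂ (archimedean ((1# + 1#) * a ⁻¹)))

  1≤b : 1# ≤ b
  1≤b = 1≤ι-suc B-1

  0<b : 0# < b
  0<b = ι-suc-pos B-1

  -- The step `h` is chosen so that `q` is 1/(1 - h), as `E-≤-^` requires.
  k⁻¹ h q : ℝ
  k⁻¹ = ι K ⁻¹
  h   = ι (suc K) ⁻¹
  q   = 1# + k⁻¹

  0≤k⁻¹ : 0# ≤ k⁻¹
  0≤k⁻¹ = <⇒≤ (⁻¹-pos (ι-suc-pos K-1))

  0<h : 0# < h
  0<h = ⁻¹-pos (ι-suc-pos K)

  Kk⁻¹≈1 : ι K * k⁻¹ ≈ 1#
  Kk⁻¹≈1 = *-inverseʳ (ι K) (0<⇒≉0 (ι-suc-pos K-1))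

  q[1-h]≈1 : q * (1# - h) ≈ 1#
  q[1-h]≈1 = begin-equality
    (1# + k⁻¹) * (1# - h)
      -- The solver knows no inverses, so the two inverse laws are exposed as correction terms that
      -- vanish in the next step.
      ≈⟨ solve 3 (λ k k⁻¹ h → (:1 :+ k⁻¹) :* (:1 :- h)
           := :1 :+ k⁻¹ :* (:1 :- (:1 :+ k) :* h) :+ h :* (k :* k⁻¹ :- :1))
           ≈-refl (ι K) k⁻¹ h ⟩
    1# + k⁻¹ * (1# - ι (suc K) * h) + h * (ι K * k⁻¹ - 1#)
      ≈⟨ +-cong (+-congˡ (*-congˡ (+-congˡ (-‿cong (*-inverseʳ _ (0<⇒≉0 (ι-suc-pos K))))))) (*-congˡ (+-congʳ Kk⁻¹≈1)) ⟩
    1# + k⁻¹ * (1# - 1#) + h * (1# - 1#)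
      ≈⟨ solve 2 (λ k⁻¹ h → :1 :+ k⁻¹ :* (:1 :- :1) :+ h :* (:1 :- :1) := :1)
           ≈-refl k⁻¹ h ⟩
    1#  ∎

  -- The difference `α - a * q` is `(α - a) - a * k⁻¹`, which is nonnegative by the choice of `K`.
  aq≤α : a * q ≤ α
  aq≤α = by-difference (*-nonneg′ 0≤k⁻¹ (x≤y⇒0≤y-x a≤K[α-a])) (begin-equality
    α - a * q
      ≈⟨ solve 4 (λ α a k k⁻¹ → α :- a :* (:1 :+ k⁻¹)
           := k⁻¹ :* (k :* (α :- a) :- a) :+ (:1 :- k :* k⁻¹) :* (α :- a)) ≈-refl α a (ι K) k⁻¹ ⟩
    k⁻¹ * (ι K * (α - a) - a) + (1# - ι K * k⁻¹) * (α - a)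
      ≈⟨ +-congˡ (*-congʳ (+-congˡ (-‿cong Kk⁻¹≈1))) ⟩
    k⁻¹ * (ι K * (α - a) - a) + (1# - 1#) * (α - a)
      ≈⟨ solve 2 (λ x y → x :+ (:1 :- :1) :* y := x) ≈-refl _ (α - a) ⟩
    k⁻¹ * (ι K * (α - a) - a)  ∎)

  1≤q : 1# ≤ q
  1≤q = by-difference 0≤k⁻¹ (solve 1 (λ x → :1 :+ x :- :1 := x) ≈-refl k⁻¹)

  0<q : 0# < q
  0<q = begin-strict
    0#  <⟨ 0<1 ⟩
    1#  ≤⟨ 1≤q ⟩
    q   ∎

  -- Consecutive intervals (a qᵗ, α qᵗ] overlap or touch, so that every
  -- threshold separates the heavy edges of some level from its light ones.
  level-of : ∀ {r} T → a < r → r ≤ α * q ^ T → ∃[ t ] t ℕ.≤ T × a * q ^ t < r × r ≤ α * q ^ t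
  level-of {r} zero    a<r r≤ = 0 , ℕ.z≤n , (begin-strict
    a * 1#  ≈⟨ *-identityʳ a ⟩
    a       <⟨ a<r ⟩
    r       ∎) , r≤
  level-of {r} (suc T) a<r r≤ with (a * q ^ suc T) <? r
  ... | yes aq<r = suc T , ℕ.≤-refl , aq<r , r≤
  ... | no  aq≮r =
    let t , t≤T , at , αt = level-of T a<r (begin
          r                ≤⟨ ≮⇒≥ aq≮r ⟩
          a * (q * q ^ T)  ≈⟨ *-assoc a q _ ⟨
          a * q * q ^ T    ≤⟨ *-monoʳ-≤ (^-nonneg T (<⇒≤ 0<q)) aq≤α ⟩
          α * q ^ T        ∎)
    in t , ℕ.m≤n⇒m≤1+n t≤T , at , αt

  module WithLevels (T : ℕ) where

    -- The number of given-up paths. This power clears the denominators of q⁻ᵗ for all t up to `T`,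
    -- so that `copies 0` can be `B` times `m`.
    m : ℕ
    m = suc K ℕ.^ T

    -- Proportional to q⁻ᵗ, so that all levels have the same total weight.
    copies : ℕ → ℕ
    copies t = B ℕ.* (K ℕ.^ t ℕ.* suc K ℕ.^ (T ℕ.∸ t))

    open Levels R m copies

    paths : List (Maybe ℕ)
    paths = levels (suc T)

    -- All three edges of a given-up path have weight `a`, the light weight of level 0 and the
    -- smallest weight in the graph. Giving up these paths therefore costs nothing in a class that
    -- misses `a`.
    heavy light : Maybe ℕ → ℝ
    heavy (just t) = α * q ^ t
    heavy nothing  = a
    light (just t) = a * q ^ t
    light nothing  = a

    kept : Maybe ℕ → Bool
    kept = Maybe.is-just

    heavy-pos : ∀ x → 0# < heavy x
    heavy-pos (just t) = *-pos 0<α (^-pos t 0<q)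
    heavy-pos nothing  = 0<a

    light-pos : ∀ x → 0# < light x
    light-pos (just t) = *-pos 0<a (^-pos t 0<q)
    light-pos nothing  = 0<a

    light≤heavy : ∀ x → light x ≤ heavy x
    light≤heavy (just t) = *-monoʳ-≤ (^-nonneg t (<⇒≤ 0<q)) a≤α
    light≤heavy nothing  = ≤-refl

    path : Fin (length paths) → Maybe ℕ
    path = List.lookup paths

    open PathForest R (λ i → heavy (path i)) (λ i → light (path i))
      (λ i → heavy-pos (path i)) (λ i → light-pos (path i)) public

    -- The weight of the outer edges of one entire level, the same for every level because `α + a`
    -- is 1.
    L : ℝ
    L = b * ι m

    copies-suc : ∀ {t} → t ℕ.< T → copies (suc t) ℕ.* suc K ≡ copies t ℕ.* K
    copies-suc {t} t<T = ≡.trans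
      (solveℕ 4 (λ b k kt st → b :*ℕ (k :*ℕ kt :*ℕ st) :*ℕ (conℕ 1 :+ℕ k)
                           :=ℕ b :*ℕ (kt :*ℕ ((conℕ 1 :+ℕ k) :*ℕ st)) :*ℕ k)
        ≡.refl B K (K ℕ.^ t) (suc K ℕ.^ (T ℕ.∸ suc t)))
      (≡.cong (λ s → B ℕ.* (K ℕ.^ t ℕ.* suc K ℕ.^ s) ℕ.* K) (≡.sym (ℕ.+-∸-assoc 1 t<T)))
      where
      open +-*-Solver using () renaming
          (solve to solveℕ; _:*_ to _:*ℕ_; _:+_ to _:+ℕ_; _:=_ to _:=ℕ_; con to conℕ)

    -- From one level to the next the number of copies shrinks by the factor `K` over `suc K`, which
    -- is the inverse of `q`.
    copies*q^ : ∀ {t} → t ℕ.≤ T → ι (copies t) * q ^ t ≈ L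
    copies*q^ {zero}  _   = begin-equality
      ι (B ℕ.* (1 ℕ.* m)) * 1#  ≈⟨ *-identityʳ _ ⟩
      ι (B ℕ.* (1 ℕ.* m))       ≡⟨ ≡.cong (λ m → ι (B ℕ.* m)) (ℕ.*-identityˡ m) ⟩
      ι (B ℕ.* m)               ≈⟨ ×1-homo-* B m ⟩
      b * ι m                   ∎
    copies*q^ {suc t} t<T = begin-equality
      c′ * (q * q ^ t)                       ≈⟨ *-identityʳ _ ⟨
      c′ * (q * q ^ t) * 1#                  ≈⟨ *-congˡ Kk⁻¹≈1 ⟨
      c′ * ((1# + k⁻¹) * q ^ t) * (ι K * k⁻¹)
        ≈⟨ solve 4 (λ c k k⁻¹ p → c :* ((:1 :+ k⁻¹) :* p) :* (k :* k⁻¹)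
              := c :* (k :* k⁻¹ :+ k) :* k⁻¹ :* p)
            ≈-refl c′ (ι K) k⁻¹ (q ^ t) ⟩
      c′ * (ι K * k⁻¹ + ι K) * k⁻¹ * q ^ t   ≈⟨ *-congʳ (*-congʳ (*-congˡ (+-congʳ Kk⁻¹≈1))) ⟩
      c′ * ι (suc K) * k⁻¹ * q ^ t           ≈⟨ *-congʳ (*-congʳ copies-ι) ⟩
      c * ι K * k⁻¹ * q ^ t                  ≈⟨ *-congʳ (*-assoc c _ _) ⟩
      c * (ι K * k⁻¹) * q ^ t                ≈⟨ *-congʳ (*-congˡ Kk⁻¹≈1) ⟩
      c * 1# * q ^ t                         ≈⟨ *-congʳ (*-identityʳ c) ⟩
      c * q ^ t                              ≈⟨ copies*q^ (ℕ.<⇒≤ t<T) ⟩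
      L                                      ∎
      where
      c  = ι (copies t)
      c′ = ι (copies (suc t))
      copies-ι : c′ * ι (suc K) ≈ c * ι K
      copies-ι = begin-equality
        c′ * ι (suc K)                 ≈⟨ ×1-homo-* (copies (suc t)) (suc K) ⟨
        ι (copies (suc t) ℕ.* suc K)   ≡⟨ ≡.cong ι (copies-suc t<T) ⟩
        ι (copies t ℕ.* K)             ≈⟨ ×1-homo-* (copies t) K ⟩
        c * ι K                        ∎

    μ-forest-≥ : ι m * (a + a) + ι (suc T) * L ≤ μ forest ⊤
    μ-forest-≥ = begin
      ι m * (a + a) + ι (suc T) * L
        ≈⟨ ∑-levels-const (λ x → heavy x + light x) (suc T) level-weight ⟨
      ∑ₗ (λ x → heavy x + light x) paths     ≤⟨ ∑≤μ-⊤ ⟩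
      μ forest ⊤                             ∎
      where
      level-weight : ∀ {t} → t ℕ.< suc T → ι (copies t) * (α * q ^ t + a * q ^ t) ≈ L
      level-weight {t} (ℕ.s≤s t≤T) = ≈-trans
        (solve 3 (λ c α x → c :* (α :* x :+ (:1 :- α) :* x) := c :* x) ≈-refl (ι (copies t)) α (q ^ t))
        (copies*q^ t≤T)

    kept-weight : ∑ₗ (λ x → select (kept x) (heavy x)) paths ≈ ι (suc T) * (α * L)
    kept-weight = ≈-trans (∑-levels-const (λ x → select (kept x) (heavy x)) (suc T) level-weight)
      (≈-trans (+-congʳ (zeroʳ _)) (+-identityˡ _))
      where
      level-weight : ∀ {t} → t ℕ.< suc T → ι (copies t) * (α * q ^ t) ≈ α * L
      level-weight {t} (ℕ.s≤s t≤T) = ≈-trans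
        (solve 3 (λ c α x → c :* (α :* x) := α :* (c :* x)) ≈-refl (ι (copies t)) α (q ^ t))
        (*-congˡ (copies*q^ t≤T))

    module _ (ℓ r : ℝ) where

      bound gain : Maybe ℕ → ℝ
      bound x = classBound ℓ r (heavy x) (light x)
      gain x  = adversaryGain (kept x) ℓ r (heavy x) (light x)

      -- Tight when the class contains both weights of the level, since then `α * (α + a)` is
      -- compared with `α`. In every other case the adversary attains the bound itself.
      bound≤gain : ∀ t → α * bound (just t) ≤ gain (just t)
      bound≤gain t with inClass ℓ r (α * q ^ t) | inClass ℓ r (a * q ^ t)
      ... | true  | true  = ≤-reflexive
        (solve 2 (λ α x → α :* (α :* x :+ (:1 :- α) :* x) := α :* x) ≈-refl α (q ^ t))
      ... | true  | false = by-difference (*-nonneg′ (*-nonneg′ 0≤a 0≤α) (^-nonneg t (<⇒≤ 0<q)))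
        (solve 2 (λ α x → α :* x :- α :* (α :* x :+ :0) := (:1 :- α) :* α :* x) ≈-refl α (q ^ t))
      ... | false | true  = by-difference (*-nonneg′ (*-nonneg′ 0≤a 0≤a) (^-nonneg t (<⇒≤ 0<q)))
        (solve 2 (λ α x → (:1 :- α) :* x :- α :* (:0 :+ (:1 :- α) :* x) := (:1 :- α) :* (:1 :- α) :* x)
            ≈-refl α (q ^ t))
      ... | false | false = ≤-reflexive (solve 1 (λ α → α :* (:0 :+ :0) := :0) ≈-refl α)

      -- The middle edge attains the full bound while only the fraction `α` is demanded; the part
      -- left over is `a` times the light weight.
      bound+≤gain : ∀ t → inClass ℓ r (α * q ^ t) ≡ false → inClass ℓ r (a * q ^ t) ≡ true →
        α * bound (just t) + a * a * q ^ t ≤ gain (just t)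
      bound+≤gain t h∉ l∈ rewrite h∉ | l∈ = ≤-reflexive
        (solve 2 (λ α x → α :* (:0 :+ (:1 :- α) :* x) :+ (:1 :- α) :* (:1 :- α) :* x := (:1 :- α) :* x)
            ≈-refl α (q ^ t))

      loss≤gain : ∀ {t} → t ℕ.≤ T → ι m * (α * bound nothing) ≤ ι (copies t) * (a * a * q ^ t)
      loss≤gain {t} t≤T = begin
        ι m * (α * bound nothing)
          ≤⟨ *-monoˡ-≤ (ι-nonneg m) (*-monoˡ-≤ 0≤α (+-mono-≤ select≤a select≤a)) ⟩
        ι m * (α * (a + a))
          -- Since `α` is `1# - a`, the difference is `m a (b a - 2 + 2 a)`, and `b a` is at least 2
          -- by the choice of `B`.
          ≤⟨ by-difference (*-nonneg′ (*-nonneg′ (ι-nonneg m) 0≤a) (+-nonneg (x≤y⇒0≤y-x 2≤ba) (+-nonneg 0≤a 0≤a)))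
            (solve 3 (λ m α b → let a = :1 :- α in
               b :* m :* (a :* a) :- m :* (α :* (a :+ a))
                     := m :* a :* (b :* a :- (:1 :+ :1) :+ (a :+ a)))
              ≈-refl (ι m) α b) ⟩
        L * (a * a)                          ≈⟨ *-congʳ (copies*q^ t≤T) ⟨
        ι (copies t) * q ^ t * (a * a)
          ≈⟨ solve 3 (λ c p x → c :* p :* x := c :* (x :* p)) ≈-refl (ι (copies t)) (q ^ t) (a * a) ⟩
        ι (copies t) * (a * a * q ^ t)       ∎
        where
        select≤a : select (inClass ℓ r a) a ≤ a
        select≤a = select-mono (inClass ℓ r a) true 0<a (λ _ → ≡.refl)

      -- If the class misses `a`, the given-up paths demand nothing. If it contains `a`, then
      -- `ℓ ≤ a`, and narrowness places `r` above `a` but not above the top weight `α * q ^ T`.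
      -- Hence `level-of` finds a level whose light edges are in the class and whose heavy edges are
      -- not, and its surplus pays for the given-up paths.
      narrow-class : ∀ {y} → 0# ≤ y → a * y ≤ α * q ^ T → ¬ (ℓ * y ≤ r) →
        α * ∑ₗ bound paths ≤ ∑ₗ gain paths
      narrow-class {y} 0≤y ay≤αq^T narrow with inClass ℓ r a in a∈
      ... | false = ∑ₗ-scale-≤ bound gain paths λ
        { (just t) → bound≤gain t
        ; nothing  → ≤-reflexive (≈-trans (*-congˡ (+-cong a∉ a∉)) (solve 1 (λ α → α :* (:0 :+ :0)
              := :0)
            ≈-refl α)) }
        where
        a∉ : select (inClass ℓ r a) a ≈ 0#
        a∉ rewrite a∈ = ≈-refl
      ... | true  =
        let ℓ≤a , a<r = inClass⁻ {ℓ} {r} {a} a∈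
            r≤top = <⇒≤ (begin-strict
              r         <⟨ ≰⇒> narrow ⟩
              ℓ * y     ≤⟨ *-monoʳ-≤ 0≤y ℓ≤a ⟩
              a * y     ≤⟨ ay≤αq^T ⟩
              α * q ^ T ∎)
            t , t≤T , at<r , r≤αt = level-of T a<r r≤top
            ℓ≤at = begin
              ℓ         ≤⟨ ℓ≤a ⟩
              a         ≈⟨ *-identityʳ a ⟨
              a * 1#    ≤⟨ *-monoˡ-≤ 0≤a (1≤x^n t 1≤q) ⟩
              a * q ^ t ∎
        in ∑-levels-≤ bound gain bound≤gain ≤-refl (ℕ.s≤s t≤T)
             (bound+≤gain t (inClass⁻-< {ℓ} r≤αt) (inClass⁺ ℓ≤at at<r)) (loss≤gain t≤T)

    ι-m-pos : 0# < ι m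
    ι-m-pos = go T
      where
      go : ∀ n → 0# < ι (suc K ℕ.^ n)
      go zero    = ι-suc-pos 0
      go (suc n) = begin-strict
        0#                               <⟨ *-pos (ι-suc-pos K) (go n) ⟩
        ι (suc K) * ι (suc K ℕ.^ n)      ≈⟨ ×1-homo-* (suc K) (suc K ℕ.^ n) ⟨
        ι (suc K ℕ.^ suc n)              ∎

    -- The optimum is at least `ι m * (a + a) + ι (suc T) * L`, while the union of the adversary's
    -- matchings yields at most `ι (suc T) * (α * L)`. The terms with `α * L` cancel, and the common
    -- factor `ι m` is divided out.
    all-narrow : ∀ {δ y k} (ℓ r : Fin k → ℝ) → 0# ≤ α - δ → 0# ≤ y → a * y ≤ α * q ^ T →
      (∀ i → ¬ (ℓ i * y ≤ r i)) →
      (∀ (M : Fin k → Subset (WeightedGraph.∣E∣ forest)) →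
       (∀ i → IsApproxMWM forest α (weightClass forest (ℓ i) (r i)) (M i)) →
       (α - δ) * μ forest ⊤ ≤ μ forest (⋃ (tabulate M))) →
      (α - δ) * (a + a) ≤ δ * (ι (suc T) * b)
    all-narrow {δ} {y} ℓ r 0≤α-δ 0≤y ay≤αq^T narrow good = *-cancelˡ-≤ ι-m-pos
      (by-difference (x≤y⇒0≤y-x (begin
        (α - δ) * (ι m * (a + a) + ι (suc T) * L)         ≤⟨ *-monoˡ-≤ 0≤α-δ μ-forest-≥ ⟩
        (α - δ) * μ forest ⊤
          ≤⟨ good M (λ i → M-approx 0≤α i (narrow-class (ℓ i) (r i) 0≤y ay≤αq^T (narrow i))) ⟩
        μ forest (⋃ (tabulate M))                         ≤⟨ μ-⋃ ⟩
        ∑ₗ (λ x → select (kept x) (heavy x)) paths        ≈⟨ kept-weight ⟩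
        ι (suc T) * (α * L)                               ∎))
        (solve 6 (λ m α δ t b a →
           m :* (δ :* (t :* b)) :- m :* ((α :- δ) :* (a :+ a))
           := t :* (α :* (b :* m)) :- (α :- δ) :* (m :* (a :+ a) :+ t :* (b :* m)))
          ≈-refl (ι m) α δ (ι (suc T)) b a))
      where
      open Adversary (λ i → kept (path i)) (λ i → light≤heavy (path i)) ℓ r

-- Choice of the constants and of the number of levels.

module Parameters (R : Reals) (α : Reals.ℝ R)
  (½<α : Reals._<_ R (Reals.½ R) α) (α<1 : Reals._<_ R α (Reals.1# R)) where
  open Weighted R hiding (zero)
  open OrderedField R
  open Exponential R
  open Construction R α ½<α α<1

  -- With `suc T` about γ/(2 b δ), the right side of `all-narrow` is at most half of `γ`, and the
  -- left side is at least `γ`. Such a `suc T` is still at least `δ₀` over `δ`, so `c * δ ⁻¹` is at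
  -- most `suc T` steps of length `h`.
  γ δ₀ c : ℝ
  γ  = α * a
  δ₀ = γ * (b + b + (b + b)) ⁻¹
  c  = δ₀ * h

  0<γ : 0# < γ
  0<γ = *-pos 0<α 0<a

  0<4b : 0# < b + b + (b + b)
  0<4b = +-pos (+-pos 0<b 0<b) (+-pos 0<b 0<b)

  0<δ₀ : 0# < δ₀
  0<δ₀ = *-pos 0<γ (⁻¹-pos 0<4b)

  0<c : 0# < c
  0<c = *-pos 0<δ₀ 0<h

  module _ {δ : ℝ} (0<δ : 0# < δ) (δ≤δ₀ : δ ≤ δ₀) where

    0≤δ : 0# ≤ δ
    0≤δ = <⇒≤ 0<δ

    4δb≤γ : δ * (b + b + (b + b)) ≤ γ
    4δb≤γ = ≤-trans (*-monoʳ-≤ (<⇒≤ 0<4b) δ≤δ₀) (≤-reflexive (x*y⁻¹*y≈x γ 0<4b))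

    4δ≤α : δ + δ + (δ + δ) ≤ α
    4δ≤α = by-difference
      (+-nonneg (+-nonneg (*-nonneg′ 0≤α 0≤α) (x≤y⇒0≤y-x 4δb≤γ))
        (*-nonneg′ (+-nonneg (+-nonneg 0≤δ 0≤δ) (+-nonneg 0≤δ 0≤δ)) (x≤y⇒0≤y-x 1≤b)))
      (solve 3 (λ α δ b → α :- (δ :+ δ :+ (δ :+ δ)) :=
          α :* α :+ (α :* (:1 :- α) :- δ :* (b :+ b :+ (b :+ b))) :+ (δ :+ δ :+ (δ :+ δ)) :* (b :- :1))
        ≈-refl α δ b)

    0≤α-δ : 0# ≤ α - δ
    0≤α-δ = ≤-trans (+-nonneg (x≤y⇒0≤y-x 4δ≤α) (+-nonneg 0≤δ (+-nonneg 0≤δ 0≤δ))) (≤-reflexive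
      (solve 2 (λ α δ → α :- (δ :+ δ :+ (δ :+ δ)) :+ (δ :+ (δ :+ δ)) := α :- δ) ≈-refl α δ))

    γ≤2a[α-δ] : γ ≤ (α - δ) * (a + a)
    γ≤2a[α-δ] = by-difference
      (*-nonneg′ 0≤a (+-nonneg (x≤y⇒0≤y-x 4δ≤α) (+-nonneg 0≤δ 0≤δ)))
      (solve 3 (λ α δ a → (α :- δ) :* (a :+ a) :- α :* a
            := a :* (α :- (δ :+ δ :+ (δ :+ δ)) :+ (δ :+ δ)))
          ≈-refl α δ a)

    0<2δb : 0# < δ * (b + b)
    0<2δb = *-pos 0<δ (+-pos 0<b 0<b)

    -- `suc T` is the floor of γ/(2 b δ). It is not zero: otherwise `γ` would be at most 2 b δ,
    -- against `4δb≤γ`.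
    height : ∃[ T ] ι (suc T) * (δ * (b + b)) ≤ γ × γ ≤ ι (suc (suc T)) * (δ * (b + b))
    height = nonzero n lower upper
      where
      x : ℝ
      x = γ * (δ * (b + b)) ⁻¹
      0≤x : 0# ≤ x
      0≤x = <⇒≤ (*-pos 0<γ (⁻¹-pos 0<2δb))
      n : ℕ
      n = proj₁ (floor x 0≤x)
      lower : ι n * (δ * (b + b)) ≤ γ
      lower =
          ≤-trans (*-monoʳ-≤ (<⇒≤ 0<2δb) (proj₁ (proj₂ (floor x 0≤x)))) (≤-reflexive (x*y⁻¹*y≈x γ 0<2δb))
      upper : γ ≤ ι (suc n) * (δ * (b + b))
      upper = ≤-trans (≤-reflexive (≈-sym (x*y⁻¹*y≈x γ 0<2δb)))
        (*-monoʳ-≤ (<⇒≤ 0<2δb) (<⇒≤ (proj₂ (proj₂ (floor x 0≤x)))))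
      nonzero : ∀ n → ι n * (δ * (b + b)) ≤ γ → γ ≤ ι (suc n) * (δ * (b + b)) →
        ∃[ T ] ι (suc T) * (δ * (b + b)) ≤ γ × γ ≤ ι (suc (suc T)) * (δ * (b + b))
      nonzero (suc T) lower upper = T , lower , upper
      nonzero zero    lower upper = ⊥-elim (<⇒≱ 0<2δb (by-difference
        (+-nonneg (x≤y⇒0≤y-x γ≤2δb) (x≤y⇒0≤y-x 4δb≤γ))
        (solve 3 (λ γ δ b → :0 :- δ :* (b :+ b)
              := δ :* (b :+ b) :- γ :+ (γ :- δ :* (b :+ b :+ (b :+ b))))
          ≈-refl γ δ b)))
        where
        γ≤2δb : γ ≤ δ * (b + b)
        γ≤2δb = ≤-trans upper (≤-reflexive (≈-trans (*-congʳ (+-identityʳ 1#)) (*-identityˡ _)))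

    module Height (T : ℕ) (lower : ι (suc T) * (δ * (b + b)) ≤ γ)
                  (upper : γ ≤ ι (suc (suc T)) * (δ * (b + b))) where

      -- Rounding down costs at most a factor 2, as T + 2 ≤ 2 (T + 1); this is why `δ₀` is defined
      -- with 4 b where `height` uses 2 b.
      δ₀≤[1+T]δ : δ₀ ≤ ι (suc T) * δ
      δ₀≤[1+T]δ = *-cancelˡ-≤ 0<4b (begin
        (b + b + (b + b)) * δ₀                    ≈⟨ *-comm _ δ₀ ⟩
        δ₀ * (b + b + (b + b))                    ≈⟨ x*y⁻¹*y≈x γ 0<4b ⟩
        γ                                         ≤⟨ upper ⟩
        ι (suc (suc T)) * (δ * (b + b))
          ≤⟨ by-difference (*-nonneg′ (ι-nonneg T) (<⇒≤ 0<2δb))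
            (solve 3 (λ t δ b → (b :+ b :+ (b :+ b)) :* ((:1 :+ t) :* δ) :- (:1 :+ (:1 :+ t)) :* (δ :* (b :+ b))
                  := t :* (δ :* (b :+ b)))
                ≈-refl (ι T) δ b) ⟩
        (b + b + (b + b)) * (ι (suc T) * δ)       ∎)

      cδ⁻¹≤[1+T]h : c * δ ⁻¹ ≤ ι (suc T) * h
      cδ⁻¹≤[1+T]h = *-cancelˡ-≤ 0<δ (begin
        δ * (c * δ ⁻¹)           ≈⟨ solve 3 (λ δ c d → δ :* (c :* d) := c :* d :* δ) ≈-refl δ c (δ ⁻¹) ⟩
        c * δ ⁻¹ * δ             ≈⟨ x*y⁻¹*y≈x c 0<δ ⟩
        δ₀ * h                   ≤⟨ *-monoʳ-≤ (<⇒≤ 0<h) δ₀≤[1+T]δ ⟩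
        ι (suc T) * δ * h
          ≈⟨ solve 3 (λ t δ h → t :* δ :* h := δ :* (t :* h)) ≈-refl (ι (suc T)) δ h ⟩
        δ * (ι (suc T) * h)      ∎)

      open WithLevels T using (forest; all-narrow)

      Good : ∀ {k} (ℓ r : Fin k → ℝ) → Set
      Good ℓ r = ∀ M → (∀ i → IsApproxMWM forest α (weightClass forest (ℓ i) (r i)) (M i)) →
        (α - δ) * μ forest ⊤ ≤ μ forest (⋃ (tabulate M))

      -- The choice of the height gives `x + x ≤ γ`, while `all-narrow` gives `γ ≤ x`; together they
      -- contradict `0# < γ`.
      ¬all-narrow : ∀ {k y} (ℓ r : Fin k → ℝ) → 0# ≤ y → y ≤ q ^ suc T → Good ℓ r → ¬ (∀ i →
        ¬ (ℓ i * y ≤ r i))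
      ¬all-narrow {y = y} ℓ r 0≤y y≤q^[1+T] good narrow = <⇒≱ 0<γ (by-difference
        (+-nonneg (x≤y⇒0≤y-x 2T′δb≤γ) (+-nonneg (x≤y⇒0≤y-x γ≤T′δb) (x≤y⇒0≤y-x γ≤T′δb)))
        (solve 3 (λ γ x b → :0 :- γ := γ :- (x :+ x) :+ (x :- γ :+ (x :- γ))) ≈-refl γ x b))
        where
        x : ℝ
        x = δ * (ι (suc T) * b)
        2T′δb≤γ : x + x ≤ γ
        2T′δb≤γ = begin
          x + x
            ≈⟨ solve 3 (λ t δ b → δ :* (t :* b) :+ δ :* (t :* b) := t :* (δ :* (b :+ b)))
                ≈-refl (ι (suc T)) δ b ⟩
          ι (suc T) * (δ * (b + b))    ≤⟨ lower ⟩
          γ                            ∎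
        -- The top level is `T`, so one of the `suc T` factors `q` is absorbed by passing from `a`
        -- to `α`.
        ay≤αq^T : a * y ≤ α * q ^ T
        ay≤αq^T = begin
          a * y            ≤⟨ *-monoˡ-≤ 0≤a y≤q^[1+T] ⟩
          a * (q * q ^ T)  ≈⟨ *-assoc a q _ ⟨
          a * q * q ^ T    ≤⟨ *-monoʳ-≤ (^-nonneg T (<⇒≤ 0<q)) aq≤α ⟩
          α * q ^ T        ∎
        γ≤T′δb : γ ≤ x
        γ≤T′δb = ≤-trans γ≤2a[α-δ] (all-narrow ℓ r 0≤α-δ 0≤y ay≤αq^T narrow good)

      -- The witness `y` is the exponential of `c * δ ⁻¹`, bounded by `q ^ suc T` since its argument
      -- is at most `suc T` steps of length `h`.
      wide-class : ∀ k (ℓ r : Fin k → ℝ) → Good ℓ r → ∃[ i ] ∃[ y ] y IsExpOf (c * δ ⁻¹) × ℓ i * y ≤ r i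
      wide-class k ℓ r good =
        let y , y-exp , 0≤y , y≤q^[1+T] = exp-exists 0≤cδ⁻¹ λ n →
              E-≤-^ (suc T) n (<⇒≤ 0<h) (<⇒≤ 0<q) q[1-h]≈1 0≤cδ⁻¹ cδ⁻¹≤[1+T]h
            -- With finitely many classes and a decidable order, refuting that all classes are
            -- narrow yields an actual index.
            i , wide = decidable-stable (any? λ i → (ℓ i * y) ≤? r i) λ ¬∃ →
              ¬all-narrow ℓ r 0≤y y≤q^[1+T] good λ i wide → ¬∃ (i , wide)
        in i , y , y-exp , wide
        where
        0≤cδ⁻¹ : 0# ≤ c * δ ⁻¹
        0≤cδ⁻¹ = <⇒≤ (*-pos 0<c (⁻¹-pos 0<δ))

claimC1 : (R : Reals) → let open Weighted R in
    ∀ α → ½ < α → α < 1# →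
    ∃[ c ] ∃[ δ₀ ] 0# < c × 0# < δ₀ ×
    (∀ δ → 0# < δ → δ ≤ δ₀ →
    Σ[ G ∈ WeightedGraph ]
    (∀ k (ℓ r : Fin k → ℝ) →
    (∀ (M : Fin k → Subset (WeightedGraph.∣E∣ G)) →
    (∀ i → IsApproxMWM G α (weightClass G (ℓ i) (r i)) (M i)) →
    (α - δ) * μ G ⊤ ≤ μ G (⋃ (tabulate M))) →
    ∃[ i ] ∃[ y ] y IsExpOf (c * δ ⁻¹) × ℓ i * y ≤ r i))
claimC1 R α ½<α α<1 = c , δ₀ , 0<c , 0<δ₀ , λ δ 0<δ δ≤δ₀ →
  -- The graph depends on `δ` only through `T`.
  let T , lower , upper = height 0<δ δ≤δ₀
      open Height 0<δ δ≤δ₀ T lower upper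
  in Construction.WithLevels.forest R α ½<α α<1 T , wide-class
  where open Parameters R α ½<α α<1
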